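{- Let $n>1$ be an integer, let $m=\prod_{p\mid n,\ p \text{ prime}} p$ be the square-free part (radical) of $n$, and let $0<a_1<a_2<\cdots<a_{\phi(n)}<n$ be the positive integers less than $n$ and coprime with $n$, listed in increasing order. Then $$\sum_{j=1}^{\phi(n)} j\,a_j=\frac{\phi(n)}{24}\left(8n\phi(n)+6n+2\phi(m)(-1)^{\omega(m)}-2^{\omega(m)}\right).$$
   Context: $\phi$ denotes Euler's totient function and $\omega(k)$ denotes the number of distinct prime factors of $k$. -}

module Defs where

open import Data.List.Base using (List; filter; applyUpTo; length)
open import Data.Nat.Base using (ℕ; suc)
open import Data.Nat.Coprimality using (coprime?)
open import Data.Nat.Divisibility using (_∣?_)
open import Data.Nat.ListAction using (product)
open import Data.Nat.Primality using (prime?)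
open import Relation.Nullary.Decidable using (_×-dec_)

[1⋯_] : ℕ → List ℕ
[1⋯ n ] = applyUpTo suc n

-- Euler's totient: the number of 1 ≤ k ≤ n coprime to n.
φ : ℕ → ℕ
φ n = length (filter (λ k → coprime? k n) [1⋯ n ])

primeDivisors : ℕ → List ℕ
primeDivisors n = filter (λ p → prime? p ×-dec p ∣? n) [1⋯ n ]

ω : ℕ → ℕ
ω n = length (primeDivisors n)

radical : ℕ → ℕ
radical n = product (primeDivisors n)

{-# OPTIONS --safe #-}

-- Write S for the weighted sum.  Since a_j is the maximum of exactly 2j − 1 ordered pairs of totatives,
-- 2 S − Σ a is the sum of max(x, y) over all such pairs, and this sum is determined by Σ a, Σ a² and
-- Σ κ(|x − y|), where κ(t) = t (n − t).  Because κ(n − t) = κ(t), the last sum runs over differences modulo n: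
-- by the Chinese remainder theorem the number of pairs with x − y ≡ t is n/m times the product over p ∣ n of
-- p − 2 + [p ∣ t].  All the sums are thus of the form Σ_t Π_{p ∣ n} (α_p + β_p [p ∣ t]) F(t) for a polynomial F,
-- and are evaluated by inclusion–exclusion from the power sums over the multiples of each d ∣ n.
module Submission where

import Algebra.Properties.CommutativeMonoid.Sum as CommutativeMonoidSum
import Algebra.Properties.Semiring.Sum as SemiringSum
open import Data.Bool.Base using (if_then_else_)
open import Data.Fin.Base as Fin using (Fin; toℕ; zero; suc)
open import Data.Fin.Properties using (toℕ<n; toℕ-fromℕ<)
import Data.Fin.Properties as Finₚ
open import Data.Integer.Base as ℤ using (ℤ; +_; -1ℤ; 0ℤ; 1ℤ)
import Data.Integer.Properties as ℤₚ
open import Data.Integer.Tactic.RingSolver using (solve-∀)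
open import Data.List.Base using (List; []; _∷_; filter; applyUpTo; length)
open import Data.List.Membership.Propositional using (_∈_)
open import Data.List.Membership.Propositional.Properties using (∈-filter⁺; ∈-filter⁻; ∈-applyUpTo⁺)
open import Data.List.Relation.Unary.All as All using (All; []; _∷_)
open import Data.List.Relation.Unary.AllPairs using ([]; _∷_)
open import Data.List.Relation.Unary.Any using (here; there)
open import Data.List.Relation.Unary.Unique.Propositional using (Unique)
import Data.List.Relation.Unary.Unique.Propositional.Properties as Uniqueₚ
open import Data.Nat.Base as ℕ using (ℕ; zero; suc; _+_; _*_; _^_; _<_; _≤_; _∸_; _⊔_; NonZero; z≤n; s≤s; ≢-nonZero; >-nonZero; >-nonZero⁻¹)
open import Data.Nat.Coprimality as Coprimality using (Coprime; coprime?)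
open import Data.Nat.Divisibility
open import Data.Nat.DivMod using (_%_; m%n<n; m≡m%n+[m/n]*n)
open import Data.Nat.GCD using (gcd; gcd[m,n]∣m; gcd[m,n]∣n; gcd[m,n]≢0; module Bézout)
open import Data.Nat.ListAction using (product)
open import Data.Nat.Primality
open import Data.Nat.Primality.Factorisation using (factorise; factorisationHasAllPrimeFactors)
open import Data.Nat.Properties using (+-0-commutativeMonoid)
import Data.Nat.Properties as ℕₚ
import Data.Nat.Tactic.RingSolver as ℕSolver
open import Algebra.Properties.CommutativeMonoid.Sum +-0-commutativeMonoid using (sum-syntax)
open import Data.Product.Base using (_×_; ∃-syntax; _,_; proj₁; proj₂)
open import Data.Rational.Base as ℚ using (_/_)
import Data.Rational.Properties as ℚₚ
import Data.Rational.Unnormalised.Base as ℚᵘ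
import Data.Rational.Unnormalised.Properties as ℚᵘₚ
open import Data.Sum.Base using (inj₁; inj₂; [_,_]′)
open import Function.Base using (_∘_; id)
open import Function.Bundles using (_⇔_; mk⇔; Equivalence)
open import Relation.Binary.Definitions using (tri<; tri≈; tri>)
open import Relation.Binary.PropositionalEquality
open import Relation.Nullary using (Dec; yes; no; ¬_; does; contradiction)
open import Relation.Nullary.Decidable using (_×-dec_; dec-true; dec-false; does-⇔)
open import Relation.Unary using (Pred; Decidable)
open import Defs

open ≡-Reasoning
open SemiringSum ℤₚ.+-*-semiring using (sum)
private
  module ∑ = SemiringSum ℤₚ.+-*-semiring
  module ℕ∑ = CommutativeMonoidSum +-0-commutativeMonoid

-- The distance |x - y| itself is not a function of x - y modulo n, so residue counts cannot
-- evaluate its sum. Since |x - y| = 2 max(x, y) - x - y, one has κ(|x - y|) = 2n max(x, y) - n (x +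
-- y) - (x - y)²: subtracting the square costs only first and second moments, and leaves a summand
-- that depends on the difference modulo n alone. The short closed form also has a reason. For d N =
-- n, the sums over d k with k < N that occur here are, up to a fixed factor, A N + B + C d with A,
-- B, C depending only on n. Inclusion-exclusion therefore returns three Euler products instead of a
-- sum over divisors. The products at A lead to φ(n) and φ(n)². The terms at B vanish, either
-- because n has a prime factor or because B = 0. The products at C give the unusual terms of the
-- formula: ∏ (1 - p) = φ(m) (-1)^ω(m) comes from Σ a², and ∏ (2p - 2) = 2^ω(m) φ(m) comes from κ.
-- Denominators are cleared throughout by the factors 2, 6 and 24, so that only the last step leaves
-- ℤ.

-- Finite sums over initial segments of ℕ.

opaque

  ∑< : ℕ → (ℕ → ℤ) → ℤ
  ∑< n f = sum {n} (λ i → f (toℕ i))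

  ∑<-cong : ∀ n {f g} → (∀ k → k < n → f k ≡ g k) → ∑< n f ≡ ∑< n g
  ∑<-cong n f≗g = ∑.sum-cong-≗ {n} (λ i → f≗g (toℕ i) (toℕ<n i))

  ∑<-+ : ∀ n f g → ∑< n (λ k → f k ℤ.+ g k) ≡ ∑< n f ℤ.+ ∑< n g
  ∑<-+ n f g = ∑.∑-distrib-+ {n} (f ∘ toℕ) (g ∘ toℕ)

  ∑<-*ˡ : ∀ n c f → ∑< n (λ k → c ℤ.* f k) ≡ c ℤ.* ∑< n f
  ∑<-*ˡ n c f = sym (∑.*-distribˡ-sum {n} c (f ∘ toℕ))

  ∑<-comm : ∀ m n (f : ℕ → ℕ → ℤ) → ∑< m (λ i → ∑< n (f i)) ≡ ∑< n (λ j → ∑< m (λ i → f i j))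
  ∑<-comm m n f = ∑.∑-comm {m} {n} (λ i j → f (toℕ i) (toℕ j))

  ∑<-const : ∀ n c → ∑< n (λ _ → c) ≡ + n ℤ.* c
  ∑<-const zero    c = refl
  ∑<-const (suc n) c = begin
    c ℤ.+ ∑< n (λ _ → c)  ≡⟨ cong (ℤ._+_ c) (∑<-const n c) ⟩
    c ℤ.+ + n ℤ.* c       ≡⟨ distrib c (+ n) ⟩
    (1ℤ ℤ.+ + n) ℤ.* c    ∎
    where
    distrib : ∀ x y → x ℤ.+ y ℤ.* x ≡ (1ℤ ℤ.+ y) ℤ.* x
    distrib = solve-∀

  ∑<-split : ∀ m n f → ∑< (m + n) f ≡ ∑< m f ℤ.+ ∑< n (λ k → f (m + k))
  ∑<-split zero    n f = sym (ℤₚ.+-identityˡ _)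
  ∑<-split (suc m) n f = trans (cong (ℤ._+_ (f 0)) (∑<-split m n (f ∘ suc))) (sym (ℤₚ.+-assoc (f 0) _ _))

  ∑<-snoc : ∀ n f → ∑< (suc n) f ≡ ∑< n f ℤ.+ f n
  ∑<-snoc zero    f = ℤₚ.+-comm (f 0) 0ℤ
  ∑<-snoc (suc n) f = trans (cong (ℤ._+_ (f 0)) (∑<-snoc n (f ∘ suc))) (sym (ℤₚ.+-assoc (f 0) _ _))

  -- The residue `i` is the outer index and the quotient `j` the inner one, so that anything of
  -- period `p` is constant on the inner sum.
  ∑<-blocks : ∀ p N f → ∑< (N * p) f ≡ ∑< p (λ i → ∑< N (λ j → f (i + p * j)))
  ∑<-blocks p zero    f = sym (trans (∑<-const p 0ℤ) (ℤₚ.*-zeroʳ (+ p)))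
  ∑<-blocks p (suc N) f = begin
    ∑< (p + N * p) f
      ≡⟨ ∑<-split p (N * p) f ⟩
    ∑< p f ℤ.+ ∑< (N * p) (λ k → f (p + k))
      ≡⟨ cong₂ ℤ._+_ (∑<-cong p λ i _ → cong f (first i p)) (∑<-blocks p N (λ k → f (p + k))) ⟩
    ∑< p (λ i → f (i + p * 0)) ℤ.+ ∑< p (λ i → ∑< N (λ j → f (p + (i + p * j))))
      ≡⟨ cong (ℤ._+_ (∑< p (λ i → f (i + p * 0)))) (∑<-cong p λ i _ → ∑<-cong N λ j _ → cong f (later i j p)) ⟩
    ∑< p (λ i → f (i + p * 0)) ℤ.+ ∑< p (λ i → ∑< N (λ j → f (i + p * suc j)))
      ≡⟨ ∑<-+ p (λ i → f (i + p * 0)) (λ i → ∑< N (λ j → f (i + p * suc j))) ⟨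
    ∑< p (λ i → ∑< (suc N) (λ j → f (i + p * j))) ∎
    where
    first : ∀ i p → i ≡ i + p * 0
    first = ℕSolver.solve-∀
    later : ∀ i j p → p + (i + p * j) ≡ i + p * (1 + j)
    later = ℕSolver.solve-∀

sum-select : ∀ {n} (f : Fin n → ℤ) i → (∀ j → j ≢ i → f j ≡ 0ℤ) → sum f ≡ f i
sum-select {suc n} f zero    off = begin
  f zero ℤ.+ sum (f ∘ suc)        ≡⟨ cong (ℤ._+_ (f zero)) (∑.sum-cong-≗ {n} (λ j → off (suc j) λ ())) ⟩
  f zero ℤ.+ sum {n} (λ _ → 0ℤ)   ≡⟨ cong (ℤ._+_ (f zero)) (∑.sum-replicate-zero n) ⟩
  f zero ℤ.+ 0ℤ                   ≡⟨ ℤₚ.+-identityʳ _ ⟩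
  f zero                          ∎
sum-select {suc n} f (suc i) off = begin
  f zero ℤ.+ sum (f ∘ suc)  ≡⟨ cong₂ ℤ._+_ (off zero λ ()) (sum-select (f ∘ suc) i λ j j≢i → off (suc j) (j≢i ∘ Finₚ.suc-injective)) ⟩
  0ℤ ℤ.+ f (suc i)          ≡⟨ ℤₚ.+-identityˡ _ ⟩
  f (suc i)                 ∎

opaque
  unfolding ∑<

  ∑<-select : ∀ n f k → k < n → (∀ j → j < n → j ≢ k → f j ≡ 0ℤ) → ∑< n f ≡ f k
  ∑<-select n f k k<n off = trans
    (sum-select (f ∘ toℕ) (Fin.fromℕ< k<n) λ j j≢k →
      off (toℕ j) (toℕ<n j) λ eq → j≢k (Finₚ.toℕ-injective (trans eq (sym (toℕ-fromℕ< k<n)))))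
    (cong f (toℕ-fromℕ< k<n))

-- Divisibility indicators and products over lists of primes.

opaque

  ⟦_⟧ : ∀ {a} {A : Set a} → Dec A → ℤ
  ⟦ a? ⟧ = if does a? then 1ℤ else 0ℤ

  ⟦⟧-true : ∀ {a} {A : Set a} (a? : Dec A) → A → ⟦ a? ⟧ ≡ 1ℤ
  ⟦⟧-true a? a = cong (if_then 1ℤ else 0ℤ) (dec-true a? a)

  ⟦⟧-false : ∀ {a} {A : Set a} (a? : Dec A) → ¬ A → ⟦ a? ⟧ ≡ 0ℤ
  ⟦⟧-false a? ¬a = cong (if_then 1ℤ else 0ℤ) (dec-false a? ¬a)

  ⟦⟧-cong : ∀ {a b} {A : Set a} {B : Set b} → (A → B) → (B → A) → (a? : Dec A) (b? : Dec B) → ⟦ a? ⟧ ≡ ⟦ b? ⟧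
  ⟦⟧-cong f g a? b? = cong (if_then 1ℤ else 0ℤ) (does-⇔ (mk⇔ f g) a? b?)

δ : ℕ → ℕ → ℤ
δ p x = ⟦ p ∣? x ⟧

-- After the decomposition into residue classes, the indicator leaves only the class of 0.
∑<-multiples : ∀ p M .{{_ : NonZero p}} (h : ℕ → ℤ) → ∑< (M * p) (λ k → δ p k ℤ.* h k) ≡ ∑< M (λ k → h (p * k))
∑<-multiples p M h = begin
  ∑< (M * p) (λ k → δ p k ℤ.* h k)
    ≡⟨ ∑<-blocks p M (λ k → δ p k ℤ.* h k) ⟩
  ∑< p (λ i → ∑< M (λ j → δ p (i + p * j) ℤ.* h (i + p * j)))
    ≡⟨ ∑<-comm p M (λ i j → δ p (i + p * j) ℤ.* h (i + p * j)) ⟩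
  ∑< M (λ j → ∑< p (λ i → δ p (i + p * j) ℤ.* h (i + p * j)))
    ≡⟨ ∑<-cong M (λ j _ → ∑<-select p (λ i → δ p (i + p * j) ℤ.* h (i + p * j)) 0 (>-nonZero⁻¹ p) (off j)) ⟩
  ∑< M (λ j → δ p (p * j) ℤ.* h (p * j))
    ≡⟨ ∑<-cong M (λ j _ → trans (cong (ℤ._* h (p * j)) (⟦⟧-true (p ∣? p * j) (m∣m*n j))) (ℤₚ.*-identityˡ _)) ⟩
  ∑< M (λ j → h (p * j)) ∎
  where
  off : ∀ j i → i < p → i ≢ 0 → δ p (i + p * j) ℤ.* h (i + p * j) ≡ 0ℤ
  off j i i<p i≢0 = cong (ℤ._* h (i + p * j)) (⟦⟧-false (p ∣? (i + p * j)) λ p∣ →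
    ℕₚ.<⇒≱ i<p (∣⇒≤ {{≢-nonZero i≢0}} (∣m+n∣m⇒∣n (subst (p ∣_) (ℕₚ.+-comm i (p * j)) p∣) (m∣m*n j))))

∏ : List ℕ → (ℕ → ℤ) → ℤ
∏ []      g = 1ℤ
∏ (p ∷ L) g = g p ℤ.* ∏ L g

∏-cong : ∀ L {f g} → (∀ {p} → p ∈ L → f p ≡ g p) → ∏ L f ≡ ∏ L g
∏-cong []      f≗g = refl
∏-cong (p ∷ L) f≗g = cong₂ ℤ._*_ (f≗g (here refl)) (∏-cong L (f≗g ∘ there))

∏-* : ∀ L f g → ∏ L (λ p → f p ℤ.* g p) ≡ ∏ L f ℤ.* ∏ L g
∏-* []      f g = refl
∏-* (p ∷ L) f g = trans (cong (f p ℤ.* g p ℤ.*_) (∏-* L f g)) (interchange (f p) (g p) _ _)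
  where
  interchange : ∀ a b c d → (a ℤ.* b) ℤ.* (c ℤ.* d) ≡ (a ℤ.* c) ℤ.* (b ℤ.* d)
  interchange = solve-∀

∏-const : ∀ L c → ∏ L (λ _ → c) ≡ c ℤ.^ length L
∏-const []      c = refl
∏-const (p ∷ L) c = cong (c ℤ.*_) (∏-const L c)

∏-zero : ∀ {L p} g → p ∈ L → g p ≡ 0ℤ → ∏ L g ≡ 0ℤ
∏-zero {p ∷ L} g (here refl) gp≡0 = cong (ℤ._* ∏ L g) gp≡0
∏-zero {q ∷ L} g (there p∈L) gp≡0 = trans (cong (g q ℤ.*_) (∏-zero g p∈L gp≡0)) (ℤₚ.*-zeroʳ (g q))

δ-periodic : ∀ p x j → δ p (x + p * j) ≡ δ p x
δ-periodic p x j = ⟦⟧-cong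
  (λ p∣ → ∣m+n∣m⇒∣n (subst (p ∣_) (ℕₚ.+-comm x (p * j)) p∣) (m∣m*n j))
  (λ p∣x → ∣m∣n⇒∣m+n p∣x (m∣m*n j))
  (p ∣? (x + p * j)) (p ∣? x)

-- Linear congruences modulo a prime.

prime∤ : ∀ {p q} → Prime p → Prime q → p ≢ q → ¬ p ∣ q
prime∤ p-prime q-prime p≢q p∣q with prime⇒irreducible q-prime p∣q
... | inj₁ refl = ¬prime[1] p-prime
... | inj₂ p≡q  = p≢q p≡q

prime∤* : ∀ {p} m n → Prime p → ¬ p ∣ m → ¬ p ∣ n → ¬ p ∣ m * n
prime∤* m n p-prime p∤m p∤n p∣mn = [ p∤m , p∤n ]′ (euclidsLemma m n p-prime p∣mn)

prime∤⇒coprime : ∀ {p m} → Prime p → ¬ p ∣ m → Coprime p m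
prime∤⇒coprime p-prime p∤m (d∣p , d∣m) with prime⇒irreducible p-prime d∣p
... | inj₁ d≡1  = d≡1
... | inj₂ refl = contradiction d∣m p∤m

module _ {p} (p-prime : Prime p) d (p∤d : ¬ p ∣ d) (s : ℕ) where

  private instance _ = prime⇒nonZero p-prime

  residue-root : ∃[ i ] p ∣ s + d * i
  residue-root with Coprimality.coprime-Bézout (prime∤⇒coprime p-prime p∤d)
  -- In this case `1 + y * d` is a multiple of `p`, so `y` is already the inverse of -d.
  ... | Bézout.+- x y eq = s * y , divides (s * x) (begin
    s + d * (s * y)    ≡⟨ factor s d y ⟩
    s * (1 + y * d)    ≡⟨ cong (s *_) eq ⟩
    s * (x * p)        ≡⟨ ℕₚ.*-assoc s x p ⟨
    s * x * p          ∎)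
    where
    factor : ∀ s d y → s + d * (s * y) ≡ s * (1 + y * d)
    factor = ℕSolver.solve-∀
  -- Here `y` is the inverse of `d` itself, and a sign is missing: in ℕ the factor `p ∸ 1` plays the
  -- part of -1.
  ... | Bézout.-+ x y eq = s * y * (p ∸ 1) , divides (s + s * x * (p ∸ 1)) (begin
    s + d * (s * y * (p ∸ 1))        ≡⟨ factor s d y (p ∸ 1) ⟩
    s + s * (p ∸ 1) * (y * d)        ≡⟨ cong (λ z → s + s * (p ∸ 1) * z) eq ⟨
    s + s * (p ∸ 1) * (1 + x * p)    ≡⟨ cong (λ z → s + s * (p ∸ 1) * (1 + x * z)) p≡ ⟨
    s + s * (p ∸ 1) * (1 + x * (1 + (p ∸ 1))) ≡⟨ collect s x (p ∸ 1) ⟩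
    (s + s * x * (p ∸ 1)) * (1 + (p ∸ 1))  ≡⟨ cong ((s + s * x * (p ∸ 1)) *_) p≡ ⟩
    (s + s * x * (p ∸ 1)) * p        ∎)
    where
    p≡ : 1 + (p ∸ 1) ≡ p
    p≡ = ℕₚ.m+[n∸m]≡n (>-nonZero⁻¹ p)
    factor : ∀ s d y q → s + d * (s * y * q) ≡ s + s * q * (y * d)
    factor = ℕSolver.solve-∀
    collect : ∀ s x q → s + s * q * (1 + x * (1 + q)) ≡ (s + s * x * q) * (1 + q)
    collect = ℕSolver.solve-∀

  residue-root-bounded : ∃[ i ] i < p × p ∣ s + d * i
  residue-root-bounded with i , p∣ ← residue-root =
    i % p , m%n<n i p , ∣m+n∣m⇒∣n (subst (p ∣_) regroup p∣) (n∣m*n (d * (i ℕ./ p)))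
    where
    q = i ℕ./ p
    shuffle : ∀ s d r q p → s + d * (r + q * p) ≡ d * q * p + (s + d * r)
    shuffle = ℕSolver.solve-∀
    regroup : s + d * i ≡ d * q * p + (s + d * (i % p))
    regroup = trans (cong (λ z → s + d * z) (m≡m%n+[m/n]*n i p)) (shuffle s d (i % p) q p)

  residue-root-< : ∀ {i j} → j < p → p ∣ s + d * i → p ∣ s + d * j → ¬ i < j
  residue-root-< {i} {j} j<p p∣i p∣j i<j = [ p∤d , p∤j∸i ]′ (euclidsLemma d (j ∸ i) p-prime p∣d[j∸i])
    where
    shuffle : ∀ s d i e → s + d * (i + e) ≡ (s + d * i) + d * e
    shuffle = ℕSolver.solve-∀
    p∣d[j∸i] : p ∣ d * (j ∸ i)
    p∣d[j∸i] = ∣m+n∣m⇒∣n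
      (subst (p ∣_) (trans (cong (λ z → s + d * z) (sym (ℕₚ.m+[n∸m]≡n (ℕₚ.<⇒≤ i<j)))) (shuffle s d i (j ∸ i))) p∣j) p∣i
    p∤j∸i : ¬ p ∣ j ∸ i
    p∤j∸i p∣j∸i = ℕₚ.<⇒≱ j<p (ℕₚ.≤-trans (∣⇒≤ {{>-nonZero (ℕₚ.m<n⇒0<n∸m i<j)}} p∣j∸i) (ℕₚ.m∸n≤m j i))

  residue-root-unique : ∀ {i j} → i < p → j < p → p ∣ s + d * i → p ∣ s + d * j → j ≡ i
  residue-root-unique {i} {j} i<p j<p p∣i p∣j with ℕₚ.<-cmp i j
  ... | tri< i<j _ _ = contradiction i<j (residue-root-< j<p p∣i p∣j)
  ... | tri≈ _ i≡j _ = sym i≡j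
  ... | tri> _ _ j<i = contradiction j<i (residue-root-< i<p p∣j p∣i)

  -- As `d` is invertible modulo `p`, the terms s + d i with i < p run once through all residues,
  -- and 0 is met exactly once.
  ∑δ≡1 : ∑< p (λ i → δ p (s + d * i)) ≡ 1ℤ
  ∑δ≡1 = trans (∑<-select p (λ i → δ p (s + d * i)) r r<p off) (⟦⟧-true (p ∣? (s + d * r)) p∣r)
    where
    r = proj₁ residue-root-bounded
    r<p = proj₁ (proj₂ residue-root-bounded)
    p∣r = proj₂ (proj₂ residue-root-bounded)
    off : ∀ j → j < p → j ≢ r → δ p (s + d * j) ≡ 0ℤ
    off j j<p j≢r = ⟦⟧-false (p ∣? (s + d * j)) λ p∣j → j≢r (residue-root-unique r<p j<p p∣r p∣j)

-- Sums of products of local factors.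

-- A form of the Chinese remainder theorem.
∑∏-periodic : ∀ (g : ℕ → ℕ → ℤ) (G : ℕ → ℤ) →
  (∀ p x j → g p (x + p * j) ≡ g p x) →
  (∀ {p} → Prime p → ∀ d → ¬ p ∣ d → ∀ s → ∑< p (λ i → g p (s + d * i)) ≡ G p) →
  ∀ {L} → All Prime L → Unique L → ∀ d → All (λ p → ¬ p ∣ d) L →
  ∀ N r → N ≡ r * product L → ∀ s →
  ∑< N (λ k → ∏ L (λ p → g p (s + d * k))) ≡ + r ℤ.* ∏ L G
∑∏-periodic g G periodic total [] [] d [] N r N≡ s =
  trans (∑<-const N 1ℤ) (cong (λ z → + z ℤ.* 1ℤ) (trans N≡ (ℕₚ.*-identityʳ r)))
∑∏-periodic g G periodic total {p ∷ L} (p-prime ∷ primes) (p∉L ∷ unique) d (p∤d ∷ L∤d) N r N≡ s = begin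
  ∑< N F
    ≡⟨ cong (λ n → ∑< n F) (trans N≡ (regroup r p (product L))) ⟩
  ∑< (M * p) F
    ≡⟨ ∑<-blocks p M F ⟩
  ∑< p (λ i → ∑< M (λ j → F (i + p * j)))
    -- With k = i + p j, the factor at `p` sees only `i`, while the remaining factors see a
    -- progression in `j` with start `s + d * i` and step `d * p`. The induction therefore needs
    -- arbitrary progressions, with a step prime to every remaining modulus.
    ≡⟨ ∑<-cong p (λ i _ → ∑<-cong M (λ j _ → separate i j)) ⟩
  ∑< p (λ i → ∑< M (λ j → g p (s + d * i) ℤ.* ∏ L (λ q → g q (s + d * i + d * p * j))))
    ≡⟨ ∑<-cong p (λ i _ → ∑<-*ˡ M (g p (s + d * i)) _) ⟩
  ∑< p (λ i → g p (s + d * i) ℤ.* ∑< M (λ j → ∏ L (λ q → g q (s + d * i + d * p * j))))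
    ≡⟨ ∑<-cong p (λ i _ → cong (g p (s + d * i) ℤ.*_)
         (∑∏-periodic g G periodic total primes unique (d * p) L∤dp M r refl (s + d * i))) ⟩
  ∑< p (λ i → g p (s + d * i) ℤ.* R)
    ≡⟨ ∑<-cong p (λ i _ → ℤₚ.*-comm (g p (s + d * i)) R) ⟩
  ∑< p (λ i → R ℤ.* g p (s + d * i))
    ≡⟨ ∑<-*ˡ p R (λ i → g p (s + d * i)) ⟩
  R ℤ.* ∑< p (λ i → g p (s + d * i))
    ≡⟨ cong (R ℤ.*_) (total p-prime d p∤d s) ⟩
  R ℤ.* G p
    ≡⟨ rotate (+ r) (∏ L G) (G p) ⟩
  + r ℤ.* (G p ℤ.* ∏ L G) ∎
  where
  M = r * product L
  R = + r ℤ.* ∏ L G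
  F : ℕ → ℤ
  F k = ∏ (p ∷ L) (λ q → g q (s + d * k))
  regroup : ∀ r p P → r * (p * P) ≡ r * P * p
  regroup = ℕSolver.solve-∀
  rotate : ∀ a b c → (a ℤ.* b) ℤ.* c ≡ a ℤ.* (c ℤ.* b)
  rotate = solve-∀
  L∤dp : All (λ q → ¬ q ∣ d * p) L
  L∤dp = All.zipWith (λ { (q-prime , q∤d , p≢q) → prime∤* d p q-prime q∤d (prime∤ q-prime p-prime (p≢q ∘ sym)) })
           (primes , All.zip (L∤d , p∉L))
  shift₁ : ∀ s d i p j → s + d * (i + p * j) ≡ s + d * i + p * (d * j)
  shift₁ = ℕSolver.solve-∀
  shift₂ : ∀ s d i p j → s + d * (i + p * j) ≡ s + d * i + d * p * j
  shift₂ = ℕSolver.solve-∀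
  separate : ∀ i j → F (i + p * j) ≡ g p (s + d * i) ℤ.* ∏ L (λ q → g q (s + d * i + d * p * j))
  separate i j = cong₂ ℤ._*_
    (trans (cong (g p) (shift₁ s d i p j)) (periodic p (s + d * i) (d * j)))
    (∏-cong L (λ {q} _ → cong (g q) (shift₂ s d i p j)))

-- Expanding the product means choosing, at each prime, either α or β times the indicator. The
-- second choice divides the number of terms `N` by p and multiplies the step `d` by p, and keeps
-- `d * N` equal to `n`. So in the closed form A N + B + C d each of the three parts stays
-- multiplicative over the primes, with local factors p α + β, α + β and α + p β.
∑∏-inclusion-exclusion : ∀ (α β : ℕ → ℤ) (F : ℕ → ℤ) c n A B C →
  (∀ d N → d * N ≡ n → c ℤ.* ∑< N (λ k → F (d * k)) ≡ A ℤ.* + N ℤ.+ B ℤ.+ C ℤ.* + d) →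
  ∀ {L} → All Prime L → Unique L → ∀ d → All (λ p → ¬ p ∣ d) L →
  ∀ N r → d * N ≡ n → N ≡ r * product L →
  c ℤ.* ∑< N (λ k → ∏ L (λ p → α p ℤ.+ β p ℤ.* δ p (d * k)) ℤ.* F (d * k)) ≡
    A ℤ.* (+ r ℤ.* ∏ L (λ p → + p ℤ.* α p ℤ.+ β p)) ℤ.+ B ℤ.* ∏ L (λ p → α p ℤ.+ β p)
      ℤ.+ C ℤ.* (+ d ℤ.* ∏ L (λ p → α p ℤ.+ + p ℤ.* β p))
∑∏-inclusion-exclusion α β F c n A B C closed [] [] d [] N r dN≡n N≡ = begin
  c ℤ.* ∑< N (λ k → 1ℤ ℤ.* F (d * k))
    ≡⟨ cong (c ℤ.*_) (∑<-cong N (λ k _ → ℤₚ.*-identityˡ _)) ⟩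
  c ℤ.* ∑< N (λ k → F (d * k))
    ≡⟨ closed d N dN≡n ⟩
  A ℤ.* + N ℤ.+ B ℤ.+ C ℤ.* + d
    ≡⟨ cong (λ z → A ℤ.* + z ℤ.+ B ℤ.+ C ℤ.* + d) (trans N≡ (ℕₚ.*-identityʳ r)) ⟩
  A ℤ.* + r ℤ.+ B ℤ.+ C ℤ.* + d
    ≡⟨ units A B C (+ r) (+ d) ⟩
  A ℤ.* (+ r ℤ.* 1ℤ) ℤ.+ B ℤ.* 1ℤ ℤ.+ C ℤ.* (+ d ℤ.* 1ℤ) ∎
  where
  units : ∀ A B C r d → A ℤ.* r ℤ.+ B ℤ.+ C ℤ.* d ≡ A ℤ.* (r ℤ.* 1ℤ) ℤ.+ B ℤ.* 1ℤ ℤ.+ C ℤ.* (d ℤ.* 1ℤ)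
  units = solve-∀
∑∏-inclusion-exclusion α β F c n A B C closed {p ∷ L} (p-prime ∷ primes) (p∉L ∷ unique) d (p∤d ∷ L∤d) N r dN≡n N≡ = begin
  c ℤ.* ∑< N (λ k → (α p ℤ.+ β p ℤ.* δ p (d * k)) ℤ.* w k ℤ.* F (d * k))
    ≡⟨ cong (c ℤ.*_) (∑<-cong N (λ k _ → expand k)) ⟩
  c ℤ.* ∑< N (λ k → α p ℤ.* H k ℤ.+ β p ℤ.* (δ p k ℤ.* H k))
    ≡⟨ cong (c ℤ.*_) (∑<-+ N (λ k → α p ℤ.* H k) (λ k → β p ℤ.* (δ p k ℤ.* H k))) ⟩
  c ℤ.* (∑< N (λ k → α p ℤ.* H k) ℤ.+ ∑< N (λ k → β p ℤ.* (δ p k ℤ.* H k)))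
    ≡⟨ cong (c ℤ.*_) (cong₂ ℤ._+_ (∑<-*ˡ N (α p) H) (∑<-*ˡ N (β p) (λ k → δ p k ℤ.* H k))) ⟩
  c ℤ.* (α p ℤ.* ∑< N H ℤ.+ β p ℤ.* ∑< N (λ k → δ p k ℤ.* H k))
    ≡⟨ cong (λ z → c ℤ.* (α p ℤ.* ∑< N H ℤ.+ β p ℤ.* z)) multiples ⟩
  c ℤ.* (α p ℤ.* ∑< N H ℤ.+ β p ℤ.* ∑< M H′)
    ≡⟨ pull c (α p) (β p) _ _ ⟩
  α p ℤ.* (c ℤ.* ∑< N H) ℤ.+ β p ℤ.* (c ℤ.* ∑< M H′)
    -- In the α branch the number of terms is unchanged, so `p` moves from the product into the
    -- cofactor, which becomes `r * p`. In the β branch `p` moves into the step.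
    ≡⟨ cong₂ (λ u v → α p ℤ.* u ℤ.+ β p ℤ.* v)
         (∑∏-inclusion-exclusion α β F c n A B C closed primes unique d L∤d N (r * p) dN≡n (trans N≡ (sym (ℕₚ.*-assoc r p _))))
         (∑∏-inclusion-exclusion α β F c n A B C closed primes unique (d * p) L∤dp M r dpM≡n refl) ⟩
  α p ℤ.* (A ℤ.* (+ (r * p) ℤ.* X) ℤ.+ B ℤ.* Y ℤ.+ C ℤ.* (+ d ℤ.* Z))
    ℤ.+ β p ℤ.* (A ℤ.* (+ r ℤ.* X) ℤ.+ B ℤ.* Y ℤ.+ C ℤ.* (+ (d * p) ℤ.* Z))
    ≡⟨ cong₂ (λ u v → α p ℤ.* (A ℤ.* (u ℤ.* X) ℤ.+ B ℤ.* Y ℤ.+ C ℤ.* (+ d ℤ.* Z))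
                    ℤ.+ β p ℤ.* (A ℤ.* (+ r ℤ.* X) ℤ.+ B ℤ.* Y ℤ.+ C ℤ.* (v ℤ.* Z)))
         (ℤₚ.pos-* r p) (ℤₚ.pos-* d p) ⟩
  α p ℤ.* (A ℤ.* (+ r ℤ.* + p ℤ.* X) ℤ.+ B ℤ.* Y ℤ.+ C ℤ.* (+ d ℤ.* Z))
    ℤ.+ β p ℤ.* (A ℤ.* (+ r ℤ.* X) ℤ.+ B ℤ.* Y ℤ.+ C ℤ.* (+ d ℤ.* + p ℤ.* Z))
    ≡⟨ collect A B C X Y Z (+ r) (+ d) (+ p) (α p) (β p) ⟩
  A ℤ.* (+ r ℤ.* ((+ p ℤ.* α p ℤ.+ β p) ℤ.* X)) ℤ.+ B ℤ.* ((α p ℤ.+ β p) ℤ.* Y)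
    ℤ.+ C ℤ.* (+ d ℤ.* ((α p ℤ.+ + p ℤ.* β p) ℤ.* Z)) ∎
  where
  instance _ = prime⇒nonZero p-prime
  M = r * product L
  X = ∏ L (λ p → + p ℤ.* α p ℤ.+ β p)
  Y = ∏ L (λ p → α p ℤ.+ β p)
  Z = ∏ L (λ p → α p ℤ.+ + p ℤ.* β p)
  w H H′ : ℕ → ℤ
  w k = ∏ L (λ q → α q ℤ.+ β q ℤ.* δ q (d * k))
  H k = w k ℤ.* F (d * k)
  H′ k = ∏ L (λ q → α q ℤ.+ β q ℤ.* δ q (d * p * k)) ℤ.* F (d * p * k)
  regroup : ∀ r p P → r * (p * P) ≡ r * P * p
  regroup = ℕSolver.solve-∀
  N≡Mp : N ≡ M * p
  N≡Mp = trans N≡ (regroup r p (product L))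
  dpM≡n : d * p * M ≡ n
  dpM≡n = trans (ℕₚ.*-assoc d p M) (trans (cong (d *_) (trans (ℕₚ.*-comm p M) (sym N≡Mp))) dN≡n)
  L∤dp : All (λ q → ¬ q ∣ d * p) L
  L∤dp = All.zipWith (λ { (q-prime , q∤d , p≢q) → prime∤* d p q-prime q∤d (prime∤ q-prime p-prime (p≢q ∘ sym)) })
           (primes , All.zip (L∤d , p∉L))
  rearrange : ∀ a b e w f → (a ℤ.+ b ℤ.* e) ℤ.* w ℤ.* f ≡ a ℤ.* (w ℤ.* f) ℤ.+ b ℤ.* (e ℤ.* (w ℤ.* f))
  rearrange = solve-∀
  expand : ∀ k → (α p ℤ.+ β p ℤ.* δ p (d * k)) ℤ.* w k ℤ.* F (d * k) ≡ α p ℤ.* H k ℤ.+ β p ℤ.* (δ p k ℤ.* H k)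
  expand k = trans
    (cong (λ z → (α p ℤ.+ β p ℤ.* z) ℤ.* w k ℤ.* F (d * k))
      (⟦⟧-cong (λ p∣dk → [ (λ p∣d → contradiction p∣d p∤d) , id ]′ (euclidsLemma d k p-prime p∣dk))
               (∣n⇒∣m*n d) (p ∣? d * k) (p ∣? k)))
    (rearrange (α p) (β p) (δ p k) (w k) (F (d * k)))
  multiples : ∑< N (λ k → δ p k ℤ.* H k) ≡ ∑< M H′
  multiples = begin
    ∑< N (λ k → δ p k ℤ.* H k)        ≡⟨ cong (λ n → ∑< n (λ k → δ p k ℤ.* H k)) N≡Mp ⟩
    ∑< (M * p) (λ k → δ p k ℤ.* H k)  ≡⟨ ∑<-multiples p M H ⟩
    ∑< M (λ k → H (p * k))            ≡⟨ ∑<-cong M (λ k _ → cong (λ z → ∏ L (λ q → α q ℤ.+ β q ℤ.* δ q z) ℤ.* F z) (sym (ℕₚ.*-assoc d p k))) ⟩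
    ∑< M H′                           ∎
  pull : ∀ c a b u v → c ℤ.* (a ℤ.* u ℤ.+ b ℤ.* v) ≡ a ℤ.* (c ℤ.* u) ℤ.+ b ℤ.* (c ℤ.* v)
  pull = solve-∀
  collect : ∀ A B C X Y Z r d p a b →
    a ℤ.* (A ℤ.* (r ℤ.* p ℤ.* X) ℤ.+ B ℤ.* Y ℤ.+ C ℤ.* (d ℤ.* Z))
      ℤ.+ b ℤ.* (A ℤ.* (r ℤ.* X) ℤ.+ B ℤ.* Y ℤ.+ C ℤ.* (d ℤ.* p ℤ.* Z)) ≡
    A ℤ.* (r ℤ.* ((p ℤ.* a ℤ.+ b) ℤ.* X)) ℤ.+ B ℤ.* ((a ℤ.+ b) ℤ.* Y)
      ℤ.+ C ℤ.* (d ℤ.* ((a ℤ.+ p ℤ.* b) ℤ.* Z))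
  collect = solve-∀

-- Prime divisors and the indicator of coprimality.

-- The list is left abstract because a list computed from the radical has to serve for `n` as well,
-- and a list for `n` has to serve for its own product.
record PrimeSupport (n : ℕ) (L : List ℕ) : Set where
  field
    primes   : All Prime L
    unique   : Unique L
    divides∈ : ∀ {p} → p ∈ L → p ∣ n
    complete : ∀ {p} → Prime p → p ∣ n → p ∈ L

primeDivisors-support : ∀ n .{{_ : NonZero n}} → PrimeSupport n (primeDivisors n)
primeDivisors-support n = record
  { primes   = All.tabulate (proj₁ ∘ prime∧∣)
  ; unique   = Uniqueₚ.filter⁺ P? (Uniqueₚ.applyUpTo⁺₁ suc n λ i<j _ → ℕₚ.<⇒≢ i<j ∘ ℕₚ.suc-injective)
  ; divides∈ = proj₂ ∘ prime∧∣
  ; complete = λ {p} p-prime p∣n → ∈-filter⁺ P? (in-range p (prime⇒nonZero p-prime) p∣n) (p-prime , p∣n)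
  }
  where
  P? = λ p → prime? p ×-dec p ∣? n
  prime∧∣ : ∀ {p} → p ∈ primeDivisors n → Prime p × p ∣ n
  prime∧∣ p∈ = proj₂ (∈-filter⁻ P? {xs = [1⋯ n ]} p∈)
  in-range : ∀ p → NonZero p → p ∣ n → p ∈ [1⋯ n ]
  in-range (suc p) _ p∣n = ∈-applyUpTo⁺ suc (∣⇒≤ p∣n)

-- Once `p` is divided out of `n`, the other primes still divide the quotient, since none of them
-- divides `p`.
distinct-primes∣⇒product∣ : ∀ {L} n → All Prime L → Unique L → All (_∣ n) L → product L ∣ n
distinct-primes∣⇒product∣ n [] [] [] = 1∣ n
distinct-primes∣⇒product∣ {p ∷ L} n (p-prime ∷ primes) (p∉L ∷ unique) (divides q refl ∷ L∣n) =
  subst (p * product L ∣_) (ℕₚ.*-comm p q) (*-monoʳ-∣ p (distinct-primes∣⇒product∣ q primes unique L∣q))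
  where
  L∣q : All (_∣ q) L
  L∣q = All.zipWith (λ { (r-prime , r∣qp , p≢r) → [ id , (λ r∣p → contradiction r∣p (prime∤ r-prime p-prime (p≢r ∘ sym))) ]′ (euclidsLemma q p r-prime r∣qp) })
          (primes , All.zip (L∣n , p∉L))

∈⇒∣product : ∀ {L p} → p ∈ L → p ∣ product L
∈⇒∣product {p ∷ L} (here refl)  = m∣m*n (product L)
∈⇒∣product {q ∷ L} (there p∈L) = ∣n⇒∣m*n q (∈⇒∣product p∈L)

product-support : ∀ {n L} → PrimeSupport n L → PrimeSupport (product L) L
product-support S = record
  { primes   = primes
  ; unique   = unique
  ; divides∈ = ∈⇒∣product
  ; complete = λ p-prime p∣ → factorisationHasAllPrimeFactors p-prime p∣ primes
  }
  where open PrimeSupport S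

≢1⇒prime∣ : ∀ n .{{_ : NonZero n}} → n ≢ 1 → ∃[ p ] Prime p × p ∣ n
≢1⇒prime∣ n n≢1 with factorise n
... | record { factors = []    ; isFactorisation = eq }                         = contradiction eq n≢1
... | record { factors = p ∷ L ; isFactorisation = eq ; factorsPrime = p-prime ∷ _ } =
  p , p-prime , subst (p ∣_) (sym eq) (m∣m*n (product L))

¬coprime⇒common-prime : ∀ m n .{{_ : NonZero n}} → ¬ Coprime m n → ∃[ p ] Prime p × p ∣ m × p ∣ n
¬coprime⇒common-prime m n ¬coprime
  with p , p-prime , p∣g ← ≢1⇒prime∣ (gcd m n) {{≢-nonZero (gcd[m,n]≢0 m n (inj₂ (ℕ.≢-nonZero⁻¹ n)))}} (¬coprime ∘ Coprimality.gcd≡1⇒coprime) =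
  p , p-prime , ∣-trans p∣g (gcd[m,n]∣m m n) , ∣-trans p∣g (gcd[m,n]∣n m n)

-- The factor 1 - δ is spelled as an instance of α + β δ with α = 1 and β = -1, the shape that
-- inclusion-exclusion expects.
χ : List ℕ → ℕ → ℤ
χ L x = ∏ L (λ p → 1ℤ ℤ.+ -1ℤ ℤ.* δ p x)

coprime≡χ : ∀ {n L} .{{_ : NonZero n}} → PrimeSupport n L → ∀ x → ⟦ coprime? x n ⟧ ≡ χ L x
coprime≡χ {n} {L} S x = by-cases (coprime? x n)
  where
  open PrimeSupport S
  p∤x : Coprime x n → ∀ {p} → p ∈ L → ¬ p ∣ x
  p∤x coprime p∈L p∣x with refl ← coprime (p∣x , divides∈ p∈L) = ¬prime[1] (All.lookup primes p∈L)
  by-cases : Dec (Coprime x n) → ⟦ coprime? x n ⟧ ≡ χ L x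
  by-cases (yes coprime) = begin
    ⟦ coprime? x n ⟧ ≡⟨ ⟦⟧-true (coprime? x n) coprime ⟩
    1ℤ               ≡⟨ ℤₚ.^-zeroˡ (length L) ⟨
    1ℤ ℤ.^ length L  ≡⟨ ∏-const L 1ℤ ⟨
    ∏ L (λ _ → 1ℤ)   ≡⟨ ∏-cong L (λ {p} p∈L → cong (λ z → 1ℤ ℤ.+ -1ℤ ℤ.* z) (⟦⟧-false (p ∣? x) (p∤x coprime p∈L))) ⟨
    χ L x            ∎
  by-cases (no ¬coprime) with p , p-prime , p∣x , p∣n ← ¬coprime⇒common-prime x n ¬coprime = trans
    (⟦⟧-false (coprime? x n) ¬coprime)
    (sym (∏-zero (λ p → 1ℤ ℤ.+ -1ℤ ℤ.* δ p x) (complete p-prime p∣n)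
      (cong (λ z → 1ℤ ℤ.+ -1ℤ ℤ.* z) (⟦⟧-true (p ∣? x) p∣x))))

χ-periodic : ∀ {n L} → PrimeSupport n L → ∀ x → χ L (n + x) ≡ χ L x
χ-periodic {n} {L} S x = ∏-cong L λ {p} p∈L → cong (λ z → 1ℤ ℤ.+ -1ℤ ℤ.* z) (periodic (PrimeSupport.divides∈ S p∈L))
  where
  periodic : ∀ {p} → p ∣ n → δ p (n + x) ≡ δ p x
  periodic {p} (divides q refl) =
    trans (cong (δ p) (trans (ℕₚ.+-comm (q * p) x) (cong (_+_ x) (ℕₚ.*-comm q p)))) (δ-periodic p x q)

opaque
  unfolding ∑< ⟦_⟧

  length-filter-applyUpTo : ∀ {a p} {A : Set a} {P : Pred A p} (P? : Decidable P) (f : ℕ → A) n →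
    + length (filter P? (applyUpTo f n)) ≡ ∑< n (λ k → ⟦ P? (f k) ⟧)
  length-filter-applyUpTo P? f zero = refl
  length-filter-applyUpTo P? f (suc n) with P? (f 0)
  ... | yes _ = cong (ℤ._+_ 1ℤ) (length-filter-applyUpTo P? (f ∘ suc) n)
  ... | no  _ = trans (length-filter-applyUpTo P? (f ∘ suc) n) (sym (ℤₚ.+-identityˡ _))

-- Counting by residues: the totient and the correlation of coprime pairs.

∤1 : ∀ {L} → All Prime L → All (λ p → ¬ p ∣ 1) L
∤1 = All.map λ p-prime p∣1 → ¬prime[1] (subst Prime (∣1⇒≡1 p∣1) p-prime)

∑[1-δ] : ∀ {p} → Prime p → ∀ d → ¬ p ∣ d → ∀ s → ∑< p (λ i → 1ℤ ℤ.+ -1ℤ ℤ.* δ p (s + d * i)) ≡ + p ℤ.- 1ℤ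
∑[1-δ] {p} p-prime d p∤d s = begin
  ∑< p (λ i → 1ℤ ℤ.+ -1ℤ ℤ.* δ p (s + d * i))
    ≡⟨ ∑<-+ p (λ _ → 1ℤ) (λ i → -1ℤ ℤ.* δ p (s + d * i)) ⟩
  ∑< p (λ _ → 1ℤ) ℤ.+ ∑< p (λ i → -1ℤ ℤ.* δ p (s + d * i))
    ≡⟨ cong₂ ℤ._+_ (trans (∑<-const p 1ℤ) (ℤₚ.*-identityʳ (+ p)))
         (trans (∑<-*ˡ p -1ℤ (λ i → δ p (s + d * i))) (cong (-1ℤ ℤ.*_) (∑δ≡1 p-prime d p∤d s))) ⟩
  + p ℤ.- 1ℤ ∎

φ-product : ∀ {n L} .{{_ : NonZero n}} → PrimeSupport n L → ∀ r → n ≡ r * product L →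
  + φ n ≡ + r ℤ.* ∏ L (λ p → + p ℤ.- 1ℤ)
φ-product {n} {L} S r n≡ = begin
  + φ n
    ≡⟨ length-filter-applyUpTo (λ k → coprime? k n) suc n ⟩
  ∑< n (λ k → ⟦ coprime? (suc k) n ⟧)
    ≡⟨ ∑<-cong n (λ k _ → trans (coprime≡χ S (suc k)) (cong (χ L) (cong suc (sym (ℕₚ.+-identityʳ k))))) ⟩
  ∑< n (λ k → χ L (1 + 1 * k))
    -- The totient counts over 1, ..., n, hence the progression with start 1 and step 1.
    ≡⟨ ∑∏-periodic (λ p x → 1ℤ ℤ.+ -1ℤ ℤ.* δ p x) (λ p → + p ℤ.- 1ℤ)
         (λ p x j → cong (λ z → 1ℤ ℤ.+ -1ℤ ℤ.* z) (δ-periodic p x j)) ∑[1-δ]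
         primes unique 1 (∤1 primes) n r n≡ 1 ⟩
  + r ℤ.* ∏ L (λ p → + p ℤ.- 1ℤ) ∎
  where open PrimeSupport S

module _ (t : ℕ) where

  private
    pair : ℕ → ℕ → ℤ
    pair p x = (1ℤ ℤ.+ -1ℤ ℤ.* δ p x) ℤ.* (1ℤ ℤ.+ -1ℤ ℤ.* δ p (x + t))

    -- If p divides x, then p divides x + t exactly when it divides t. This replaces a product of
    -- two indicators that both vary with x by a constant times one of them, so `pair` becomes
    -- linear and `∑δ≡1` can sum it.
    δ-shift : ∀ p x → δ p x ℤ.* δ p (x + t) ≡ δ p t ℤ.* δ p x
    δ-shift p x = by-cases (p ∣? x)
      where
      by-cases : Dec (p ∣ x) → δ p x ℤ.* δ p (x + t) ≡ δ p t ℤ.* δ p x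
      by-cases (yes p∣x) = trans (ℤₚ.*-comm (δ p x) (δ p (x + t)))
        (cong (ℤ._* δ p x) (⟦⟧-cong (λ p∣ → ∣m+n∣m⇒∣n p∣ p∣x) (∣m∣n⇒∣m+n p∣x) (p ∣? (x + t)) (p ∣? t)))
      by-cases (no p∤x)  = trans (cong (ℤ._* δ p (x + t)) δpx≡0) (sym (trans (cong (δ p t ℤ.*_) δpx≡0) (ℤₚ.*-zeroʳ (δ p t))))
        where
        δpx≡0 : δ p x ≡ 0ℤ
        δpx≡0 = ⟦⟧-false (p ∣? x) p∤x

    pair-expand : ∀ p x → pair p x ≡ (1ℤ ℤ.+ -1ℤ ℤ.* δ p (x + t)) ℤ.+ (δ p t ℤ.- 1ℤ) ℤ.* δ p x
    pair-expand p x = begin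
      pair p x
        ≡⟨ expand (δ p x) (δ p (x + t)) ⟩
      (1ℤ ℤ.+ -1ℤ ℤ.* δ p (x + t)) ℤ.- δ p x ℤ.+ δ p x ℤ.* δ p (x + t)
        ≡⟨ cong (ℤ._+_ ((1ℤ ℤ.+ -1ℤ ℤ.* δ p (x + t)) ℤ.- δ p x)) (δ-shift p x) ⟩
      (1ℤ ℤ.+ -1ℤ ℤ.* δ p (x + t)) ℤ.- δ p x ℤ.+ δ p t ℤ.* δ p x
        ≡⟨ collect (δ p x) (δ p (x + t)) (δ p t) ⟩
      (1ℤ ℤ.+ -1ℤ ℤ.* δ p (x + t)) ℤ.+ (δ p t ℤ.- 1ℤ) ℤ.* δ p x ∎
      where
      expand : ∀ a b → (1ℤ ℤ.+ -1ℤ ℤ.* a) ℤ.* (1ℤ ℤ.+ -1ℤ ℤ.* b) ≡ (1ℤ ℤ.+ -1ℤ ℤ.* b) ℤ.- a ℤ.+ a ℤ.* b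
      expand = solve-∀
      collect : ∀ a b c → (1ℤ ℤ.+ -1ℤ ℤ.* b) ℤ.- a ℤ.+ c ℤ.* a ≡ (1ℤ ℤ.+ -1ℤ ℤ.* b) ℤ.+ (c ℤ.- 1ℤ) ℤ.* a
      collect = solve-∀

    shift : ∀ s d i → s + d * i + t ≡ s + t + d * i
    shift s d i = swap s (d * i) t
      where
      swap : ∀ a b c → a + b + c ≡ a + c + b
      swap = ℕSolver.solve-∀

    -- Of the p residues, 0 and -t are excluded; the two coincide exactly when p divides t. The
    -- factor `1ℤ` again fits the form α + β δ.
    ∑pair : ∀ {p} → Prime p → ∀ d → ¬ p ∣ d → ∀ s → ∑< p (λ i → pair p (s + d * i)) ≡ (+ p ℤ.- + 2) ℤ.+ 1ℤ ℤ.* δ p t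
    ∑pair {p} p-prime d p∤d s = begin
      ∑< p (λ i → pair p (s + d * i))
        ≡⟨ ∑<-cong p (λ i _ → trans (pair-expand p (s + d * i))
             (cong (λ z → (1ℤ ℤ.+ -1ℤ ℤ.* δ p z) ℤ.+ (δ p t ℤ.- 1ℤ) ℤ.* δ p (s + d * i)) (shift s d i))) ⟩
      ∑< p (λ i → (1ℤ ℤ.+ -1ℤ ℤ.* δ p (s + t + d * i)) ℤ.+ (δ p t ℤ.- 1ℤ) ℤ.* δ p (s + d * i))
        ≡⟨ ∑<-+ p (λ i → 1ℤ ℤ.+ -1ℤ ℤ.* δ p (s + t + d * i)) (λ i → (δ p t ℤ.- 1ℤ) ℤ.* δ p (s + d * i)) ⟩
      ∑< p (λ i → 1ℤ ℤ.+ -1ℤ ℤ.* δ p (s + t + d * i)) ℤ.+ ∑< p (λ i → (δ p t ℤ.- 1ℤ) ℤ.* δ p (s + d * i))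
        ≡⟨ cong₂ ℤ._+_ (∑[1-δ] p-prime d p∤d (s + t))
             (trans (∑<-*ˡ p (δ p t ℤ.- 1ℤ) (λ i → δ p (s + d * i))) (cong ((δ p t ℤ.- 1ℤ) ℤ.*_) (∑δ≡1 p-prime d p∤d s))) ⟩
      (+ p ℤ.- 1ℤ) ℤ.+ (δ p t ℤ.- 1ℤ) ℤ.* 1ℤ
        ≡⟨ collect (+ p) (δ p t) ⟩
      (+ p ℤ.- + 2) ℤ.+ 1ℤ ℤ.* δ p t ∎
      where
      collect : ∀ p c → (p ℤ.- 1ℤ) ℤ.+ (c ℤ.- 1ℤ) ℤ.* 1ℤ ≡ (p ℤ.- + 2) ℤ.+ 1ℤ ℤ.* c
      collect = solve-∀

    pair-periodic : ∀ p x j → pair p (x + p * j) ≡ pair p x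
    pair-periodic p x j = cong₂ (λ a b → (1ℤ ℤ.+ -1ℤ ℤ.* a) ℤ.* (1ℤ ℤ.+ -1ℤ ℤ.* b))
      (δ-periodic p x j)
      (trans (cong (δ p) (swap x (p * j) t)) (δ-periodic p (x + t) j))
      where
      swap : ∀ a b c → a + b + c ≡ a + c + b
      swap = ℕSolver.solve-∀

  χ-correlation : ∀ {n L} → PrimeSupport n L → ∀ r → n ≡ r * product L →
    ∑< n (λ y → χ L y ℤ.* χ L (y + t)) ≡ + r ℤ.* ∏ L (λ p → (+ p ℤ.- + 2) ℤ.+ 1ℤ ℤ.* δ p t)
  χ-correlation {n} {L} S r n≡ = begin
    ∑< n (λ y → χ L y ℤ.* χ L (y + t))
      ≡⟨ ∑<-cong n (λ y _ → trans (sym (∏-* L (λ p → 1ℤ ℤ.+ -1ℤ ℤ.* δ p y) (λ p → 1ℤ ℤ.+ -1ℤ ℤ.* δ p (y + t))))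
           (cong (λ z → ∏ L (λ p → pair p z)) (sym (ℕₚ.+-identityʳ y)))) ⟩
    ∑< n (λ y → ∏ L (λ p → pair p (0 + 1 * y)))
      ≡⟨ ∑∏-periodic pair (λ p → (+ p ℤ.- + 2) ℤ.+ 1ℤ ℤ.* δ p t) pair-periodic ∑pair
           primes unique 1 (∤1 primes) n r n≡ 0 ⟩
    + r ℤ.* ∏ L (λ p → (+ p ℤ.- + 2) ℤ.+ 1ℤ ℤ.* δ p t) ∎
    where open PrimeSupport S

∑<-inclusion-exclusion : ∀ (α β : ℕ → ℤ) (F : ℕ → ℤ) c n A B C →
  (∀ d N → d * N ≡ n → c ℤ.* ∑< N (λ k → F (d * k)) ≡ A ℤ.* + N ℤ.+ B ℤ.+ C ℤ.* + d) →
  ∀ {L} → PrimeSupport n L → ∀ r → n ≡ r * product L →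
  c ℤ.* ∑< n (λ k → ∏ L (λ p → α p ℤ.+ β p ℤ.* δ p k) ℤ.* F k) ≡
    A ℤ.* (+ r ℤ.* ∏ L (λ p → + p ℤ.* α p ℤ.+ β p)) ℤ.+ B ℤ.* ∏ L (λ p → α p ℤ.+ β p)
      ℤ.+ C ℤ.* ∏ L (λ p → α p ℤ.+ + p ℤ.* β p)
∑<-inclusion-exclusion α β F c n A B C closed {L} S r n≡ = begin
  c ℤ.* ∑< n f
    ≡⟨ cong (c ℤ.*_) (∑<-cong n (λ k _ → cong f (sym (ℕₚ.*-identityˡ k)))) ⟩
  c ℤ.* ∑< n (λ k → f (1 * k))
    ≡⟨ ∑∏-inclusion-exclusion α β F c n A B C closed primes unique 1 (∤1 primes) n r (ℕₚ.*-identityˡ n) n≡ ⟩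
  A ℤ.* (+ r ℤ.* X) ℤ.+ B ℤ.* Y ℤ.+ C ℤ.* (1ℤ ℤ.* Z)
    ≡⟨ cong (λ z → A ℤ.* (+ r ℤ.* X) ℤ.+ B ℤ.* Y ℤ.+ C ℤ.* z) (ℤₚ.*-identityˡ Z) ⟩
  A ℤ.* (+ r ℤ.* X) ℤ.+ B ℤ.* Y ℤ.+ C ℤ.* Z ∎
  where
  open PrimeSupport S
  X = ∏ L (λ p → + p ℤ.* α p ℤ.+ β p)
  Y = ∏ L (λ p → α p ℤ.+ β p)
  Z = ∏ L (λ p → α p ℤ.+ + p ℤ.* β p)
  f : ℕ → ℤ
  f k = ∏ L (λ p → α p ℤ.+ β p ℤ.* δ p k) ℤ.* F k

-- Power sums over the multiples of a divisor.

∑<-empty : ∀ f → ∑< 0 f ≡ 0ℤ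
∑<-empty f = trans (∑<-cong 0 {f} {λ _ → 0ℤ} (λ _ ())) (∑<-const 0 0ℤ)

2∑k : ∀ N → + 2 ℤ.* ∑< N (λ k → + k) ≡ + N ℤ.* (+ N ℤ.- 1ℤ)
2∑k zero    = cong (+ 2 ℤ.*_) (∑<-empty (λ k → + k))
2∑k (suc N) = begin
  + 2 ℤ.* ∑< (suc N) (λ k → + k)              ≡⟨ cong (+ 2 ℤ.*_) (∑<-snoc N (λ k → + k)) ⟩
  + 2 ℤ.* (∑< N (λ k → + k) ℤ.+ + N)          ≡⟨ ℤₚ.*-distribˡ-+ (+ 2) (∑< N (λ k → + k)) (+ N) ⟩
  + 2 ℤ.* ∑< N (λ k → + k) ℤ.+ + 2 ℤ.* + N    ≡⟨ cong (ℤ._+ + 2 ℤ.* + N) (2∑k N) ⟩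
  + N ℤ.* (+ N ℤ.- 1ℤ) ℤ.+ + 2 ℤ.* + N        ≡⟨ step (+ N) ⟩
  (1ℤ ℤ.+ + N) ℤ.* (1ℤ ℤ.+ + N ℤ.- 1ℤ)        ∎
  where
  step : ∀ x → x ℤ.* (x ℤ.- 1ℤ) ℤ.+ + 2 ℤ.* x ≡ (1ℤ ℤ.+ x) ℤ.* (1ℤ ℤ.+ x ℤ.- 1ℤ)
  step = solve-∀

6∑k² : ∀ N → + 6 ℤ.* ∑< N (λ k → + k ℤ.* + k) ≡ + N ℤ.* (+ N ℤ.- 1ℤ) ℤ.* (+ 2 ℤ.* + N ℤ.- 1ℤ)
6∑k² zero    = cong (+ 6 ℤ.*_) (∑<-empty (λ k → + k ℤ.* + k))
6∑k² (suc N) = begin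
  + 6 ℤ.* ∑< (suc N) (λ k → + k ℤ.* + k)
    ≡⟨ cong (+ 6 ℤ.*_) (∑<-snoc N (λ k → + k ℤ.* + k)) ⟩
  + 6 ℤ.* (∑< N (λ k → + k ℤ.* + k) ℤ.+ + N ℤ.* + N)
    ≡⟨ ℤₚ.*-distribˡ-+ (+ 6) (∑< N (λ k → + k ℤ.* + k)) (+ N ℤ.* + N) ⟩
  + 6 ℤ.* ∑< N (λ k → + k ℤ.* + k) ℤ.+ + 6 ℤ.* (+ N ℤ.* + N)
    ≡⟨ cong (ℤ._+ + 6 ℤ.* (+ N ℤ.* + N)) (6∑k² N) ⟩
  + N ℤ.* (+ N ℤ.- 1ℤ) ℤ.* (+ 2 ℤ.* + N ℤ.- 1ℤ) ℤ.+ + 6 ℤ.* (+ N ℤ.* + N)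
    ≡⟨ step (+ N) ⟩
  (1ℤ ℤ.+ + N) ℤ.* (1ℤ ℤ.+ + N ℤ.- 1ℤ) ℤ.* (+ 2 ℤ.* (1ℤ ℤ.+ + N) ℤ.- 1ℤ) ∎
  where
  step : ∀ x → x ℤ.* (x ℤ.- 1ℤ) ℤ.* (+ 2 ℤ.* x ℤ.- 1ℤ) ℤ.+ + 6 ℤ.* (x ℤ.* x)
             ≡ (1ℤ ℤ.+ x) ℤ.* (1ℤ ℤ.+ x ℤ.- 1ℤ) ℤ.* (+ 2 ℤ.* (1ℤ ℤ.+ x) ℤ.- 1ℤ)
  step = solve-∀

∑dk : ∀ d N → + 2 ℤ.* ∑< N (λ k → + (d * k)) ≡ + d ℤ.* (+ N ℤ.* (+ N ℤ.- 1ℤ))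
∑dk d N = begin
  + 2 ℤ.* ∑< N (λ k → + (d * k))        ≡⟨ cong (+ 2 ℤ.*_) (trans (∑<-cong N (λ k _ → ℤₚ.pos-* d k)) (∑<-*ˡ N (+ d) (λ k → + k))) ⟩
  + 2 ℤ.* (+ d ℤ.* ∑< N (λ k → + k))    ≡⟨ swap (+ 2) (+ d) _ ⟩
  + d ℤ.* (+ 2 ℤ.* ∑< N (λ k → + k))    ≡⟨ cong (+ d ℤ.*_) (2∑k N) ⟩
  + d ℤ.* (+ N ℤ.* (+ N ℤ.- 1ℤ))        ∎
  where
  swap : ∀ a b c → a ℤ.* (b ℤ.* c) ≡ b ℤ.* (a ℤ.* c)
  swap = solve-∀

∑[dk]² : ∀ d N → + 6 ℤ.* ∑< N (λ k → + (d * k) ℤ.* + (d * k)) ≡ + d ℤ.* + d ℤ.* (+ N ℤ.* (+ N ℤ.- 1ℤ) ℤ.* (+ 2 ℤ.* + N ℤ.- 1ℤ))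
∑[dk]² d N = begin
  + 6 ℤ.* ∑< N (λ k → + (d * k) ℤ.* + (d * k))
    ≡⟨ cong (+ 6 ℤ.*_) (trans (∑<-cong N square) (∑<-*ˡ N (+ d ℤ.* + d) (λ k → + k ℤ.* + k))) ⟩
  + 6 ℤ.* (+ d ℤ.* + d ℤ.* ∑< N (λ k → + k ℤ.* + k))
    ≡⟨ swap (+ 6) (+ d ℤ.* + d) _ ⟩
  + d ℤ.* + d ℤ.* (+ 6 ℤ.* ∑< N (λ k → + k ℤ.* + k))
    ≡⟨ cong (+ d ℤ.* + d ℤ.*_) (6∑k² N) ⟩
  + d ℤ.* + d ℤ.* (+ N ℤ.* (+ N ℤ.- 1ℤ) ℤ.* (+ 2 ℤ.* + N ℤ.- 1ℤ)) ∎
  where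
  swap : ∀ a b c → a ℤ.* (b ℤ.* c) ≡ b ℤ.* (a ℤ.* c)
  swap = solve-∀
  regroup : ∀ d k → (d ℤ.* k) ℤ.* (d ℤ.* k) ≡ d ℤ.* d ℤ.* (k ℤ.* k)
  regroup = solve-∀
  square : ∀ k → k < N → + (d * k) ℤ.* + (d * k) ≡ + d ℤ.* + d ℤ.* (+ k ℤ.* + k)
  square k _ = trans (cong (λ z → z ℤ.* z) (ℤₚ.pos-* d k)) (regroup (+ d) (+ k))

κ : ℤ → ℤ → ℤ
κ n t = n ℤ.* t ℤ.+ -1ℤ ℤ.* (t ℤ.* t)

∑κ : ∀ n d N → + 6 ℤ.* ∑< N (λ k → κ n (+ (d * k))) ≡
  + 3 ℤ.* n ℤ.* (+ d ℤ.* (+ N ℤ.* (+ N ℤ.- 1ℤ))) ℤ.- + d ℤ.* + d ℤ.* (+ N ℤ.* (+ N ℤ.- 1ℤ) ℤ.* (+ 2 ℤ.* + N ℤ.- 1ℤ))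
∑κ n d N = begin
  + 6 ℤ.* ∑< N (λ k → κ n (+ (d * k)))
    ≡⟨ cong (+ 6 ℤ.*_) (trans (∑<-+ N (λ k → n ℤ.* + (d * k)) (λ k → -1ℤ ℤ.* (+ (d * k) ℤ.* + (d * k))))
         (cong₂ ℤ._+_ (∑<-*ˡ N n (λ k → + (d * k))) (∑<-*ˡ N -1ℤ (λ k → + (d * k) ℤ.* + (d * k))))) ⟩
  + 6 ℤ.* (n ℤ.* ∑< N (λ k → + (d * k)) ℤ.+ -1ℤ ℤ.* ∑< N (λ k → + (d * k) ℤ.* + (d * k)))
    ≡⟨ regroup n _ _ ⟩
  + 3 ℤ.* n ℤ.* (+ 2 ℤ.* ∑< N (λ k → + (d * k))) ℤ.- + 6 ℤ.* ∑< N (λ k → + (d * k) ℤ.* + (d * k))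
    ≡⟨ cong₂ (λ u v → + 3 ℤ.* n ℤ.* u ℤ.- v) (∑dk d N) (∑[dk]² d N) ⟩
  + 3 ℤ.* n ℤ.* (+ d ℤ.* (+ N ℤ.* (+ N ℤ.- 1ℤ))) ℤ.- + d ℤ.* + d ℤ.* (+ N ℤ.* (+ N ℤ.- 1ℤ) ℤ.* (+ 2 ℤ.* + N ℤ.- 1ℤ)) ∎
  where
  regroup : ∀ n a b → + 6 ℤ.* (n ℤ.* a ℤ.+ -1ℤ ℤ.* b) ≡ + 3 ℤ.* n ℤ.* (+ 2 ℤ.* a) ℤ.- + 6 ℤ.* b
  regroup = solve-∀

-- Moments of the totatives and of their differences.

module Moments {n L} (1<n : 1 < n) (S : PrimeSupport n L) where

  open PrimeSupport S

  private
    instance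
      n≢0 : NonZero n
      n≢0 = >-nonZero (ℕₚ.<-trans (s≤s z≤n) 1<n)

    r = quotient (distinct-primes∣⇒product∣ n primes unique (All.tabulate divides∈))

    n≡ : n ≡ r * product L
    n≡ = _∣_.equality (distinct-primes∣⇒product∣ n primes unique (All.tabulate divides∈))

    P = ∏ L (λ p → + p ℤ.- 1ℤ)

    dN≡n⇒ : ∀ d N → d * N ≡ n → + n ≡ + d ℤ.* + N
    dN≡n⇒ d N dN≡n = trans (cong +_ (sym dN≡n)) (ℤₚ.pos-* d N)

    -- An empty product would be 1: here n > 1 supplies a prime factor. This removes the constant
    -- terms of the power sums from the first two moments.
    ∏0≡0 : ∏ L (λ _ → 1ℤ ℤ.+ -1ℤ) ≡ 0ℤ
    ∏0≡0 with p , p-prime , p∣n ← ≢1⇒prime∣ n (λ n≡1 → ℕₚ.<⇒≢ 1<n (sym n≡1)) =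
      ∏-zero (λ _ → 1ℤ ℤ.+ -1ℤ) (complete p-prime p∣n) refl

    φ≡ : + r ℤ.* ∏ L (λ p → + p ℤ.* 1ℤ ℤ.+ -1ℤ) ≡ + φ n
    φ≡ = sym (trans (φ-product S r n≡) (cong (+ r ℤ.*_) (∏-cong L λ {p} _ → cong (ℤ._- 1ℤ) (sym (ℤₚ.*-identityʳ (+ p))))))

  -- This is ∏ (1 - p) over the primes of `L`, the third Euler product for the coprimality
  -- indicator, already written with the totient of the radical.
  ε : ℤ
  ε = + φ (product L) ℤ.* -1ℤ ℤ.^ length L

  private
    ε≡ : ∏ L (λ p → 1ℤ ℤ.+ + p ℤ.* -1ℤ) ≡ ε
    ε≡ = begin
      ∏ L (λ p → 1ℤ ℤ.+ + p ℤ.* -1ℤ)         ≡⟨ ∏-cong L (λ {p} _ → negate (+ p)) ⟩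
      ∏ L (λ p → (+ p ℤ.- 1ℤ) ℤ.* -1ℤ)       ≡⟨ ∏-* L (λ p → + p ℤ.- 1ℤ) (λ _ → -1ℤ) ⟩
      P ℤ.* ∏ L (λ _ → -1ℤ)                  ≡⟨ cong (P ℤ.*_) (∏-const L -1ℤ) ⟩
      P ℤ.* -1ℤ ℤ.^ length L                 ≡⟨ cong (ℤ._* -1ℤ ℤ.^ length L) (sym φ[product]) ⟩
      ε                                      ∎
      where
      negate : ∀ x → 1ℤ ℤ.+ x ℤ.* -1ℤ ≡ (x ℤ.- 1ℤ) ℤ.* -1ℤ
      negate = solve-∀
      product≢0 : NonZero (product L)
      product≢0 = productOfPrimes≢0 primes
      φ[product] : + φ (product L) ≡ P
      φ[product] = trans (φ-product {{product≢0}} (product-support S) 1 (sym (ℕₚ.*-identityˡ _))) (ℤₚ.*-identityˡ P)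

  ∑χ·x : + 2 ℤ.* ∑< n (λ x → χ L x ℤ.* + x) ≡ + n ℤ.* + φ n
  ∑χ·x = begin
    + 2 ℤ.* ∑< n (λ x → χ L x ℤ.* + x)
      ≡⟨ ∑<-inclusion-exclusion (λ _ → 1ℤ) (λ _ → -1ℤ) (λ x → + x) (+ 2) n (+ n) (ℤ.- + n) 0ℤ closed S r n≡ ⟩
    + n ℤ.* (+ r ℤ.* ∏ L (λ p → + p ℤ.* 1ℤ ℤ.+ -1ℤ)) ℤ.+ ℤ.- + n ℤ.* ∏ L (λ _ → 1ℤ ℤ.+ -1ℤ) ℤ.+ 0ℤ ℤ.* Z
      ≡⟨ cong₂ (λ u v → + n ℤ.* u ℤ.+ ℤ.- + n ℤ.* v ℤ.+ 0ℤ ℤ.* Z) φ≡ ∏0≡0 ⟩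
    + n ℤ.* + φ n ℤ.+ ℤ.- + n ℤ.* 0ℤ ℤ.+ 0ℤ ℤ.* Z
      ≡⟨ simplify (+ n) (+ φ n) Z ⟩
    + n ℤ.* + φ n ∎
    where
    Z = ∏ L (λ p → 1ℤ ℤ.+ + p ℤ.* -1ℤ)
    simplify : ∀ n f z → n ℤ.* f ℤ.+ ℤ.- n ℤ.* 0ℤ ℤ.+ 0ℤ ℤ.* z ≡ n ℤ.* f
    simplify = solve-∀
    algebra : ∀ d N → d ℤ.* (N ℤ.* (N ℤ.- 1ℤ)) ≡ (d ℤ.* N) ℤ.* N ℤ.+ ℤ.- (d ℤ.* N) ℤ.+ 0ℤ ℤ.* d
    algebra = solve-∀
    closed : ∀ d N → d * N ≡ n → + 2 ℤ.* ∑< N (λ k → + (d * k)) ≡ + n ℤ.* + N ℤ.+ ℤ.- + n ℤ.+ 0ℤ ℤ.* + d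
    closed d N dN≡n = trans (∑dk d N) (trans (algebra (+ d) (+ N))
      (cong (λ z → z ℤ.* + N ℤ.+ ℤ.- z ℤ.+ 0ℤ ℤ.* + d) (sym (dN≡n⇒ d N dN≡n))))

  ∑χ·x² : + 6 ℤ.* ∑< n (λ x → χ L x ℤ.* (+ x ℤ.* + x)) ≡ + n ℤ.* (+ 2 ℤ.* + n ℤ.* + φ n ℤ.+ ε)
  ∑χ·x² = begin
    + 6 ℤ.* ∑< n (λ x → χ L x ℤ.* (+ x ℤ.* + x))
      -- For d N = n, d² N (N - 1)(2N - 1) = 2n² N - 3n² + n d, which gives the three coefficients.
      ≡⟨ ∑<-inclusion-exclusion (λ _ → 1ℤ) (λ _ → -1ℤ) (λ x → + x ℤ.* + x) (+ 6) n
           (+ 2 ℤ.* + n ℤ.* + n) (ℤ.- + 3 ℤ.* + n ℤ.* + n) (+ n) closed S r n≡ ⟩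
    + 2 ℤ.* + n ℤ.* + n ℤ.* (+ r ℤ.* ∏ L (λ p → + p ℤ.* 1ℤ ℤ.+ -1ℤ)) ℤ.+ ℤ.- + 3 ℤ.* + n ℤ.* + n ℤ.* ∏ L (λ _ → 1ℤ ℤ.+ -1ℤ)
      ℤ.+ + n ℤ.* ∏ L (λ p → 1ℤ ℤ.+ + p ℤ.* -1ℤ)
      ≡⟨ cong₂ ℤ._+_ (cong₂ (λ u v → + 2 ℤ.* + n ℤ.* + n ℤ.* u ℤ.+ ℤ.- + 3 ℤ.* + n ℤ.* + n ℤ.* v) φ≡ ∏0≡0) (cong (+ n ℤ.*_) ε≡) ⟩
    + 2 ℤ.* + n ℤ.* + n ℤ.* + φ n ℤ.+ ℤ.- + 3 ℤ.* + n ℤ.* + n ℤ.* 0ℤ ℤ.+ + n ℤ.* ε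
      ≡⟨ simplify (+ n) (+ φ n) ε ⟩
    + n ℤ.* (+ 2 ℤ.* + n ℤ.* + φ n ℤ.+ ε) ∎
    where
    simplify : ∀ n f e → + 2 ℤ.* n ℤ.* n ℤ.* f ℤ.+ ℤ.- + 3 ℤ.* n ℤ.* n ℤ.* 0ℤ ℤ.+ n ℤ.* e ≡ n ℤ.* (+ 2 ℤ.* n ℤ.* f ℤ.+ e)
    simplify = solve-∀
    algebra : ∀ d N → d ℤ.* d ℤ.* (N ℤ.* (N ℤ.- 1ℤ) ℤ.* (+ 2 ℤ.* N ℤ.- 1ℤ)) ≡
      + 2 ℤ.* (d ℤ.* N) ℤ.* (d ℤ.* N) ℤ.* N ℤ.+ ℤ.- + 3 ℤ.* (d ℤ.* N) ℤ.* (d ℤ.* N) ℤ.+ (d ℤ.* N) ℤ.* d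
    algebra = solve-∀
    closed : ∀ d N → d * N ≡ n → + 6 ℤ.* ∑< N (λ k → + (d * k) ℤ.* + (d * k)) ≡
      + 2 ℤ.* + n ℤ.* + n ℤ.* + N ℤ.+ ℤ.- + 3 ℤ.* + n ℤ.* + n ℤ.+ + n ℤ.* + d
    closed d N dN≡n = trans (∑[dk]² d N) (trans (algebra (+ d) (+ N))
      (cong (λ z → + 2 ℤ.* z ℤ.* z ℤ.* + N ℤ.+ ℤ.- + 3 ℤ.* z ℤ.* z ℤ.+ z ℤ.* + d) (sym (dN≡n⇒ d N dN≡n))))

  ∑κ·correlation : + 6 ℤ.* ∑< n (λ t → κ (+ n) (+ t) ℤ.* ∑< n (λ y → χ L y ℤ.* χ L (y + t))) ≡
    + n ℤ.* (+ n ℤ.* + φ n ℤ.* + φ n ℤ.- (+ 2) ℤ.^ length L ℤ.* + φ n)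
  ∑κ·correlation = begin
    + 6 ℤ.* ∑< n (λ t → κ (+ n) (+ t) ℤ.* ∑< n (λ y → χ L y ℤ.* χ L (y + t)))
      ≡⟨ cong (+ 6 ℤ.*_) (trans (∑<-cong n (λ t _ → trans (cong (κ (+ n) (+ t) ℤ.*_) (χ-correlation t S r n≡))
             (rotate (κ (+ n) (+ t)) (+ r) (∏ L (λ p → (+ p ℤ.- + 2) ℤ.+ 1ℤ ℤ.* δ p t)))))
           (∑<-*ˡ n (+ r) (λ t → ∏ L (λ p → (+ p ℤ.- + 2) ℤ.+ 1ℤ ℤ.* δ p t) ℤ.* κ (+ n) (+ t)))) ⟩
    + 6 ℤ.* (+ r ℤ.* ∑< n (λ t → ∏ L (λ p → (+ p ℤ.- + 2) ℤ.+ 1ℤ ℤ.* δ p t) ℤ.* κ (+ n) (+ t)))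
      ≡⟨ swap (+ 6) (+ r) _ ⟩
    + r ℤ.* (+ 6 ℤ.* ∑< n (λ t → ∏ L (λ p → (+ p ℤ.- + 2) ℤ.+ 1ℤ ℤ.* δ p t) ℤ.* κ (+ n) (+ t)))
      -- For d N = n, 3n · d N (N - 1) - d² N (N - 1)(2N - 1) = n² N - n d: the constants 3n²
      -- cancel. With α = p - 2 and β = 1 the local factors are p (p - 2) + 1 = (p - 1)² and (p - 2)
      -- + p = 2 (p - 1); the latter is the origin of 2^ω.
      ≡⟨ cong (+ r ℤ.*_) (∑<-inclusion-exclusion (λ p → + p ℤ.- + 2) (λ _ → 1ℤ) (λ t → κ (+ n) (+ t)) (+ 6) n
           (+ n ℤ.* + n) 0ℤ (ℤ.- + n) closed S r n≡) ⟩
    + r ℤ.* (+ n ℤ.* + n ℤ.* (+ r ℤ.* ∏ L (λ p → + p ℤ.* (+ p ℤ.- + 2) ℤ.+ 1ℤ)) ℤ.+ 0ℤ ℤ.* Y ℤ.+ ℤ.- + n ℤ.* ∏ L (λ p → (+ p ℤ.- + 2) ℤ.+ + p ℤ.* 1ℤ))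
      ≡⟨ cong₂ (λ u v → + r ℤ.* (+ n ℤ.* + n ℤ.* (+ r ℤ.* u) ℤ.+ 0ℤ ℤ.* Y ℤ.+ ℤ.- + n ℤ.* v)) squares doubles ⟩
    + r ℤ.* (+ n ℤ.* + n ℤ.* (+ r ℤ.* (P ℤ.* P)) ℤ.+ 0ℤ ℤ.* Y ℤ.+ ℤ.- + n ℤ.* (W ℤ.* P))
      ≡⟨ regroup (+ r) (+ n) P Y W ⟩
    + n ℤ.* (+ n ℤ.* (+ r ℤ.* P) ℤ.* (+ r ℤ.* P) ℤ.- W ℤ.* (+ r ℤ.* P))
      ≡⟨ cong (λ f → + n ℤ.* (+ n ℤ.* f ℤ.* f ℤ.- W ℤ.* f)) (sym (φ-product S r n≡)) ⟩
    + n ℤ.* (+ n ℤ.* + φ n ℤ.* + φ n ℤ.- W ℤ.* + φ n) ∎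
    where
    W = (+ 2) ℤ.^ length L
    Y = ∏ L (λ p → (+ p ℤ.- + 2) ℤ.+ 1ℤ)
    rotate : ∀ a b c → a ℤ.* (b ℤ.* c) ≡ b ℤ.* (c ℤ.* a)
    rotate = solve-∀
    swap : ∀ a b c → a ℤ.* (b ℤ.* c) ≡ b ℤ.* (a ℤ.* c)
    swap = solve-∀
    regroup : ∀ r n P Y W → r ℤ.* (n ℤ.* n ℤ.* (r ℤ.* (P ℤ.* P)) ℤ.+ 0ℤ ℤ.* Y ℤ.+ ℤ.- n ℤ.* (W ℤ.* P)) ≡
      n ℤ.* (n ℤ.* (r ℤ.* P) ℤ.* (r ℤ.* P) ℤ.- W ℤ.* (r ℤ.* P))
    regroup = solve-∀
    square : ∀ x → x ℤ.* (x ℤ.- + 2) ℤ.+ 1ℤ ≡ (x ℤ.- 1ℤ) ℤ.* (x ℤ.- 1ℤ)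
    square = solve-∀
    squares : ∏ L (λ p → + p ℤ.* (+ p ℤ.- + 2) ℤ.+ 1ℤ) ≡ P ℤ.* P
    squares = trans (∏-cong L (λ {p} _ → square (+ p))) (∏-* L (λ p → + p ℤ.- 1ℤ) (λ p → + p ℤ.- 1ℤ))
    double : ∀ x → (x ℤ.- + 2) ℤ.+ x ℤ.* 1ℤ ≡ + 2 ℤ.* (x ℤ.- 1ℤ)
    double = solve-∀
    doubles : ∏ L (λ p → (+ p ℤ.- + 2) ℤ.+ + p ℤ.* 1ℤ) ≡ W ℤ.* P
    doubles = trans (∏-cong L (λ {p} _ → double (+ p)))
      (trans (∏-* L (λ _ → + 2) (λ p → + p ℤ.- 1ℤ)) (cong (ℤ._* P) (∏-const L (+ 2))))
    algebra : ∀ d N → + 3 ℤ.* (d ℤ.* N) ℤ.* (d ℤ.* (N ℤ.* (N ℤ.- 1ℤ))) ℤ.- d ℤ.* d ℤ.* (N ℤ.* (N ℤ.- 1ℤ) ℤ.* (+ 2 ℤ.* N ℤ.- 1ℤ)) ≡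
      (d ℤ.* N) ℤ.* (d ℤ.* N) ℤ.* N ℤ.+ 0ℤ ℤ.+ ℤ.- (d ℤ.* N) ℤ.* d
    algebra = solve-∀
    closed : ∀ d N → d * N ≡ n → + 6 ℤ.* ∑< N (λ k → κ (+ n) (+ (d * k))) ≡ + n ℤ.* + n ℤ.* + N ℤ.+ 0ℤ ℤ.+ ℤ.- + n ℤ.* + d
    closed d N dN≡n = begin
      + 6 ℤ.* ∑< N (λ k → κ (+ n) (+ (d * k)))
        ≡⟨ ∑κ (+ n) d N ⟩
      + 3 ℤ.* + n ℤ.* (+ d ℤ.* (+ N ℤ.* (+ N ℤ.- 1ℤ))) ℤ.- + d ℤ.* + d ℤ.* (+ N ℤ.* (+ N ℤ.- 1ℤ) ℤ.* (+ 2 ℤ.* + N ℤ.- 1ℤ))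
        ≡⟨ cong (λ z → + 3 ℤ.* z ℤ.* (+ d ℤ.* (+ N ℤ.* (+ N ℤ.- 1ℤ))) ℤ.- + d ℤ.* + d ℤ.* (+ N ℤ.* (+ N ℤ.- 1ℤ) ℤ.* (+ 2 ℤ.* + N ℤ.- 1ℤ))) (dN≡n⇒ d N dN≡n) ⟩
      + 3 ℤ.* (+ d ℤ.* + N) ℤ.* (+ d ℤ.* (+ N ℤ.* (+ N ℤ.- 1ℤ))) ℤ.- + d ℤ.* + d ℤ.* (+ N ℤ.* (+ N ℤ.- 1ℤ) ℤ.* (+ 2 ℤ.* + N ℤ.- 1ℤ))
        ≡⟨ algebra (+ d) (+ N) ⟩
      (+ d ℤ.* + N) ℤ.* (+ d ℤ.* + N) ℤ.* + N ℤ.+ 0ℤ ℤ.+ ℤ.- (+ d ℤ.* + N) ℤ.* + d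
        ≡⟨ cong (λ z → z ℤ.* z ℤ.* + N ℤ.+ 0ℤ ℤ.+ ℤ.- z ℤ.* + d) (sym (dN≡n⇒ d N dN≡n)) ⟩
      + n ℤ.* + n ℤ.* + N ℤ.+ 0ℤ ℤ.+ ℤ.- + n ℤ.* + d ∎

-- From maxima to differences modulo n.

-- With d = |x − y| this is d (n − d), written as an affine function of max(x, y).
Δ : ℤ → ℕ → ℕ → ℤ
Δ n y x = (+ 2 ℤ.* n) ℤ.* + (y ⊔ x)
  ℤ.+ ((+ 2 ℤ.* + y ℤ.- n) ℤ.* + x
  ℤ.+ (-1ℤ ℤ.* (+ x ℤ.* + x)
  ℤ.+ (ℤ.- (n ℤ.* + y) ℤ.- + y ℤ.* + y)))

-- The substitution is x ≡ y + t modulo n = y + b. For x at or above y, t is the distance itself. An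
-- x below y wraps around to t = b + x, where the distance y - x is n - t; the symmetry of κ and the
-- period of `c` absorb the change.
∑Δ-row : ∀ (c : ℕ → ℤ) y b → (∀ x → c (y + b + x) ≡ c x) →
  ∑< (y + b) (λ x → c x ℤ.* Δ (+ (y + b)) y x) ≡ ∑< (y + b) (λ t → κ (+ (y + b)) (+ t) ℤ.* c (y + t))
∑Δ-row c y b periodic = begin
  ∑< (y + b) (λ x → c x ℤ.* Δ n y x)
    ≡⟨ ∑<-split y b (λ x → c x ℤ.* Δ n y x) ⟩
  ∑< y (λ x → c x ℤ.* Δ n y x) ℤ.+ ∑< b (λ t → c (y + t) ℤ.* Δ n y (y + t))
    ≡⟨ cong₂ ℤ._+_ (∑<-cong y below) (∑<-cong b above) ⟩
  ∑< y (λ x → κ n (+ (b + x)) ℤ.* c (y + (b + x))) ℤ.+ ∑< b (λ t → κ n (+ t) ℤ.* c (y + t))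
    ≡⟨ ℤₚ.+-comm (∑< y (λ x → κ n (+ (b + x)) ℤ.* c (y + (b + x)))) _ ⟩
  ∑< b (λ t → κ n (+ t) ℤ.* c (y + t)) ℤ.+ ∑< y (λ x → κ n (+ (b + x)) ℤ.* c (y + (b + x)))
    ≡⟨ ∑<-split b y (λ t → κ n (+ t) ℤ.* c (y + t)) ⟨
  ∑< (b + y) (λ t → κ n (+ t) ℤ.* c (y + t))
    ≡⟨ cong (λ N → ∑< N (λ t → κ n (+ t) ℤ.* c (y + t))) (ℕₚ.+-comm b y) ⟩
  ∑< (y + b) (λ t → κ n (+ t) ℤ.* c (y + t)) ∎
  where
  n = + (y + b)
  below-algebra : ∀ c x y b →
    c ℤ.* ((+ 2 ℤ.* (y ℤ.+ b)) ℤ.* y ℤ.+ ((+ 2 ℤ.* y ℤ.- (y ℤ.+ b)) ℤ.* x ℤ.+ (-1ℤ ℤ.* (x ℤ.* x) ℤ.+ (ℤ.- ((y ℤ.+ b) ℤ.* y) ℤ.- y ℤ.* y))))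
      ≡ ((y ℤ.+ b) ℤ.* (b ℤ.+ x) ℤ.+ -1ℤ ℤ.* ((b ℤ.+ x) ℤ.* (b ℤ.+ x))) ℤ.* c
  below-algebra = solve-∀
  below : ∀ x → x < y → c x ℤ.* Δ n y x ≡ κ n (+ (b + x)) ℤ.* c (y + (b + x))
  below x x<y = begin
    c x ℤ.* Δ n y x
      ≡⟨ cong (λ z → c x ℤ.* ((+ 2 ℤ.* n) ℤ.* + z ℤ.+ ((+ 2 ℤ.* + y ℤ.- n) ℤ.* + x ℤ.+ (-1ℤ ℤ.* (+ x ℤ.* + x) ℤ.+ (ℤ.- (n ℤ.* + y) ℤ.- + y ℤ.* + y)))))
           (ℕₚ.m≥n⇒m⊔n≡m (ℕₚ.<⇒≤ x<y)) ⟩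
    c x ℤ.* ((+ 2 ℤ.* n) ℤ.* + y ℤ.+ ((+ 2 ℤ.* + y ℤ.- n) ℤ.* + x ℤ.+ (-1ℤ ℤ.* (+ x ℤ.* + x) ℤ.+ (ℤ.- (n ℤ.* + y) ℤ.- + y ℤ.* + y))))
      ≡⟨ below-algebra (c x) (+ x) (+ y) (+ b) ⟩
    κ n (+ (b + x)) ℤ.* c x
      ≡⟨ cong (κ n (+ (b + x)) ℤ.*_) (trans (sym (periodic x)) (cong c (ℕₚ.+-assoc y b x))) ⟩
    κ n (+ (b + x)) ℤ.* c (y + (b + x)) ∎
  above-algebra : ∀ c t y n →
    c ℤ.* ((+ 2 ℤ.* n) ℤ.* (y ℤ.+ t) ℤ.+ ((+ 2 ℤ.* y ℤ.- n) ℤ.* (y ℤ.+ t) ℤ.+ (-1ℤ ℤ.* ((y ℤ.+ t) ℤ.* (y ℤ.+ t)) ℤ.+ (ℤ.- (n ℤ.* y) ℤ.- y ℤ.* y))))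
      ≡ (n ℤ.* t ℤ.+ -1ℤ ℤ.* (t ℤ.* t)) ℤ.* c
  above-algebra = solve-∀
  above : ∀ t → t < b → c (y + t) ℤ.* Δ n y (y + t) ≡ κ n (+ t) ℤ.* c (y + t)
  above t _ = trans
    (cong (λ z → c (y + t) ℤ.* ((+ 2 ℤ.* n) ℤ.* + z ℤ.+ ((+ 2 ℤ.* + y ℤ.- n) ℤ.* + (y + t) ℤ.+ (-1ℤ ℤ.* (+ (y + t) ℤ.* + (y + t)) ℤ.+ (ℤ.- (n ℤ.* + y) ℤ.- + y ℤ.* + y)))))
      (ℕₚ.m≤n⇒m⊔n≡n (ℕₚ.m≤m+n y t)))
    (above-algebra (c (y + t)) (+ t) (+ y) n)

∑∑Δ : ∀ n (c : ℕ → ℤ) → (∀ x → c (n + x) ≡ c x) →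
  ∑< n (λ y → c y ℤ.* ∑< n (λ x → c x ℤ.* Δ (+ n) y x)) ≡
  ∑< n (λ t → κ (+ n) (+ t) ℤ.* ∑< n (λ y → c y ℤ.* c (y + t)))
∑∑Δ n c periodic = begin
  ∑< n (λ y → c y ℤ.* ∑< n (λ x → c x ℤ.* Δ (+ n) y x))
    ≡⟨ ∑<-cong n (λ y y<n → cong (c y ℤ.*_) (row y y<n)) ⟩
  ∑< n (λ y → c y ℤ.* ∑< n (λ t → κ (+ n) (+ t) ℤ.* c (y + t)))
    ≡⟨ ∑<-cong n (λ y _ → sym (∑<-*ˡ n (c y) (λ t → κ (+ n) (+ t) ℤ.* c (y + t)))) ⟩
  ∑< n (λ y → ∑< n (λ t → c y ℤ.* (κ (+ n) (+ t) ℤ.* c (y + t))))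
    ≡⟨ ∑<-comm n n (λ y t → c y ℤ.* (κ (+ n) (+ t) ℤ.* c (y + t))) ⟩
  ∑< n (λ t → ∑< n (λ y → c y ℤ.* (κ (+ n) (+ t) ℤ.* c (y + t))))
    ≡⟨ ∑<-cong n (λ t _ → trans (∑<-cong n (λ y _ → swap (c y) (κ (+ n) (+ t)) (c (y + t))))
         (∑<-*ˡ n (κ (+ n) (+ t)) (λ y → c y ℤ.* c (y + t)))) ⟩
  ∑< n (λ t → κ (+ n) (+ t) ℤ.* ∑< n (λ y → c y ℤ.* c (y + t))) ∎
  where
  swap : ∀ a b c → a ℤ.* (b ℤ.* c) ≡ b ℤ.* (a ℤ.* c)
  swap = solve-∀
  row : ∀ y → y < n → ∑< n (λ x → c x ℤ.* Δ (+ n) y x) ≡ ∑< n (λ t → κ (+ n) (+ t) ℤ.* c (y + t))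
  row y y<n = subst (λ N → ∑< N (λ x → c x ℤ.* Δ (+ N) y x) ≡ ∑< N (λ t → κ (+ N) (+ t) ℤ.* c (y + t))) y+b≡n
    (∑Δ-row c y (n ∸ y) (λ x → trans (cong (λ N → c (N + x)) y+b≡n) (periodic x)))
    where
    y+b≡n : y + (n ∸ y) ≡ n
    y+b≡n = ℕₚ.m+[n∸m]≡n (ℕₚ.<⇒≤ y<n)

-- Sums along the increasing sequence of totatives.

-- The bracketing is that of `Δ n y` for fixed `y`. The row sums of Δ have the same shape again, so
-- the double sum takes two applications.
sum-affine : ∀ k (u v w z : ℤ) (f g h : Fin k → ℤ) →
  sum (λ i → u ℤ.* f i ℤ.+ (v ℤ.* g i ℤ.+ (w ℤ.* h i ℤ.+ z))) ≡ u ℤ.* sum f ℤ.+ (v ℤ.* sum g ℤ.+ (w ℤ.* sum h ℤ.+ + k ℤ.* z))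
sum-affine zero    u v w z f g h = zeros u v w z
  where
  zeros : ∀ u v w z → 0ℤ ≡ u ℤ.* 0ℤ ℤ.+ (v ℤ.* 0ℤ ℤ.+ (w ℤ.* 0ℤ ℤ.+ 0ℤ ℤ.* z))
  zeros = solve-∀
sum-affine (suc k) u v w z f g h = begin
  (u ℤ.* f zero ℤ.+ (v ℤ.* g zero ℤ.+ (w ℤ.* h zero ℤ.+ z))) ℤ.+ sum (λ i → u ℤ.* f (suc i) ℤ.+ (v ℤ.* g (suc i) ℤ.+ (w ℤ.* h (suc i) ℤ.+ z)))
    ≡⟨ cong (ℤ._+_ (u ℤ.* f zero ℤ.+ (v ℤ.* g zero ℤ.+ (w ℤ.* h zero ℤ.+ z)))) (sum-affine k u v w z (f ∘ suc) (g ∘ suc) (h ∘ suc)) ⟩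
  (u ℤ.* f zero ℤ.+ (v ℤ.* g zero ℤ.+ (w ℤ.* h zero ℤ.+ z))) ℤ.+ (u ℤ.* sum (f ∘ suc) ℤ.+ (v ℤ.* sum (g ∘ suc) ℤ.+ (w ℤ.* sum (h ∘ suc) ℤ.+ + k ℤ.* z)))
    ≡⟨ regroup u v w z (f zero) (g zero) (h zero) (sum (f ∘ suc)) (sum (g ∘ suc)) (sum (h ∘ suc)) (+ k) ⟩
  u ℤ.* (f zero ℤ.+ sum (f ∘ suc)) ℤ.+ (v ℤ.* (g zero ℤ.+ sum (g ∘ suc)) ℤ.+ (w ℤ.* (h zero ℤ.+ sum (h ∘ suc)) ℤ.+ (1ℤ ℤ.+ + k) ℤ.* z)) ∎
  where
  regroup : ∀ u v w z f g h F G H k →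
    (u ℤ.* f ℤ.+ (v ℤ.* g ℤ.+ (w ℤ.* h ℤ.+ z))) ℤ.+ (u ℤ.* F ℤ.+ (v ℤ.* G ℤ.+ (w ℤ.* H ℤ.+ k ℤ.* z))) ≡
    u ℤ.* (f ℤ.+ F) ℤ.+ (v ℤ.* (g ℤ.+ G) ℤ.+ (w ℤ.* (h ℤ.+ H) ℤ.+ (1ℤ ℤ.+ k) ℤ.* z))
  regroup = solve-∀

sum-Δ : ∀ {k} n (a : Fin k → ℕ) →
  sum (λ j → sum (λ i → Δ n (a j) (a i))) ≡
    + 2 ℤ.* n ℤ.* sum (λ j → sum (λ i → + (a j ⊔ a i)))
      ℤ.- + 2 ℤ.* n ℤ.* + k ℤ.* sum (λ i → + a i)
      ℤ.- + 2 ℤ.* + k ℤ.* sum (λ i → + a i ℤ.* + a i)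
      ℤ.+ + 2 ℤ.* sum (λ i → + a i) ℤ.* sum (λ i → + a i)
sum-Δ {k} n a = begin
  sum (λ j → sum (λ i → Δ n (a j) (a i)))
    ≡⟨ ∑.sum-cong-≗ {k} row ⟩
  sum (λ j → + 2 ℤ.* n ℤ.* sum (λ i → + (a j ⊔ a i)) ℤ.+ ((+ 2 ℤ.* T ℤ.- + k ℤ.* n) ℤ.* + a j ℤ.+ (ℤ.- + k ℤ.* (+ a j ℤ.* + a j) ℤ.+ (ℤ.- n ℤ.* T ℤ.- U))))
    ≡⟨ sum-affine k (+ 2 ℤ.* n) (+ 2 ℤ.* T ℤ.- + k ℤ.* n) (ℤ.- + k) (ℤ.- n ℤ.* T ℤ.- U)
         (λ j → sum (λ i → + (a j ⊔ a i))) (λ j → + a j) (λ j → + a j ℤ.* + a j) ⟩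
  + 2 ℤ.* n ℤ.* M ℤ.+ ((+ 2 ℤ.* T ℤ.- + k ℤ.* n) ℤ.* T ℤ.+ (ℤ.- + k ℤ.* U ℤ.+ + k ℤ.* (ℤ.- n ℤ.* T ℤ.- U)))
    ≡⟨ collect n M T U (+ k) ⟩
  + 2 ℤ.* n ℤ.* M ℤ.- + 2 ℤ.* n ℤ.* + k ℤ.* T ℤ.- + 2 ℤ.* + k ℤ.* U ℤ.+ + 2 ℤ.* T ℤ.* T ∎
  where
  T = sum (λ i → + a i)
  U = sum (λ i → + a i ℤ.* + a i)
  M = sum (λ j → sum (λ i → + (a j ⊔ a i)))
  collect : ∀ n M T U k → + 2 ℤ.* n ℤ.* M ℤ.+ ((+ 2 ℤ.* T ℤ.- k ℤ.* n) ℤ.* T ℤ.+ (ℤ.- k ℤ.* U ℤ.+ k ℤ.* (ℤ.- n ℤ.* T ℤ.- U))) ≡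
    + 2 ℤ.* n ℤ.* M ℤ.- + 2 ℤ.* n ℤ.* k ℤ.* T ℤ.- + 2 ℤ.* k ℤ.* U ℤ.+ + 2 ℤ.* T ℤ.* T
  collect = solve-∀
  regroup : ∀ n m T U y k → + 2 ℤ.* n ℤ.* m ℤ.+ ((+ 2 ℤ.* y ℤ.- n) ℤ.* T ℤ.+ (-1ℤ ℤ.* U ℤ.+ k ℤ.* (ℤ.- (n ℤ.* y) ℤ.- y ℤ.* y))) ≡
    + 2 ℤ.* n ℤ.* m ℤ.+ ((+ 2 ℤ.* T ℤ.- k ℤ.* n) ℤ.* y ℤ.+ (ℤ.- k ℤ.* (y ℤ.* y) ℤ.+ (ℤ.- n ℤ.* T ℤ.- U)))
  regroup = solve-∀
  row : ∀ j → sum (λ i → Δ n (a j) (a i)) ≡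
    + 2 ℤ.* n ℤ.* sum (λ i → + (a j ⊔ a i)) ℤ.+ ((+ 2 ℤ.* T ℤ.- + k ℤ.* n) ℤ.* + a j ℤ.+ (ℤ.- + k ℤ.* (+ a j ℤ.* + a j) ℤ.+ (ℤ.- n ℤ.* T ℤ.- U)))
  row j = trans
    (sum-affine k (+ 2 ℤ.* n) (+ 2 ℤ.* + a j ℤ.- n) -1ℤ (ℤ.- (n ℤ.* + a j) ℤ.- + a j ℤ.* + a j)
      (λ i → + (a j ⊔ a i)) (λ i → + a i) (λ i → + a i ℤ.* + a i))
    (regroup n (sum (λ i → + (a j ⊔ a i))) T U (+ a j) (+ k))

-- Adding the plain sum turns the multiplicity 2j - 1 into 2j. The induction strips the least value
-- a₀: its row and column of the table of maxima contribute a₀ + 2 T, where T is the sum of the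
-- other values, and 2 T is just what it costs to raise every other rank by one.
sum-max : ∀ {k} (a : Fin k → ℕ) → (∀ {i j} → i Fin.< j → a i < a j) →
  sum (λ j → sum (λ i → + (a j ⊔ a i))) ℤ.+ sum (λ i → + a i) ≡ + 2 ℤ.* sum (λ j → + suc (toℕ j) ℤ.* + a j)
sum-max {zero}  a a-mono = refl
sum-max {suc k} a a-mono = begin
  (+ (a zero ⊔ a zero) ℤ.+ sum (λ i → + (a zero ⊔ a (suc i)))) ℤ.+ sum (λ j → + (a (suc j) ⊔ a zero) ℤ.+ sum (λ i → + (a (suc j) ⊔ a (suc i)))) ℤ.+ (+ a zero ℤ.+ T)
    ≡⟨ cong (ℤ._+ (+ a zero ℤ.+ T)) (cong₂ ℤ._+_
         (cong₂ ℤ._+_ (cong +_ (ℕₚ.⊔-idem (a zero))) (∑.sum-cong-≗ {k} λ i → cong +_ (ℕₚ.m≤n⇒m⊔n≡n (a₀≤ i))))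
         (trans (∑.∑-distrib-+ {k} (λ j → + (a (suc j) ⊔ a zero)) (λ j → sum (λ i → + (a (suc j) ⊔ a (suc i)))))
           (cong (ℤ._+ M) (∑.sum-cong-≗ {k} λ j → cong +_ (ℕₚ.m≥n⇒m⊔n≡m (a₀≤ j)))))) ⟩
  (+ a zero ℤ.+ T) ℤ.+ (T ℤ.+ M) ℤ.+ (+ a zero ℤ.+ T)
    ≡⟨ regroup (+ a zero) T M ⟩
  + 2 ℤ.* + a zero ℤ.+ + 2 ℤ.* T ℤ.+ (M ℤ.+ T)
    ≡⟨ cong (ℤ._+_ (+ 2 ℤ.* + a zero ℤ.+ + 2 ℤ.* T)) (sum-max (a ∘ suc) (a-mono ∘ s≤s)) ⟩
  + 2 ℤ.* + a zero ℤ.+ + 2 ℤ.* T ℤ.+ + 2 ℤ.* S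
    ≡⟨ collect (+ a zero) T S ⟩
  + 2 ℤ.* (1ℤ ℤ.* + a zero ℤ.+ (T ℤ.+ S))
    ≡⟨ cong (λ z → + 2 ℤ.* (1ℤ ℤ.* + a zero ℤ.+ z)) (trans
         (sym (∑.∑-distrib-+ {k} (λ j → + a (suc j)) (λ j → + suc (toℕ j) ℤ.* + a (suc j))))
         (∑.sum-cong-≗ {k} λ j → next (+ suc (toℕ j)) (+ a (suc j)))) ⟩
  + 2 ℤ.* (1ℤ ℤ.* + a zero ℤ.+ sum (λ j → + suc (suc (toℕ j)) ℤ.* + a (suc j))) ∎
  where
  T = sum (λ i → + a (suc i))
  M = sum (λ j → sum (λ i → + (a (suc j) ⊔ a (suc i))))
  S = sum (λ j → + suc (toℕ j) ℤ.* + a (suc j))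
  a₀≤ : ∀ i → a zero ≤ a (suc i)
  a₀≤ i = ℕₚ.<⇒≤ (a-mono (s≤s z≤n))
  regroup : ∀ a T M → (a ℤ.+ T) ℤ.+ (T ℤ.+ M) ℤ.+ (a ℤ.+ T) ≡ + 2 ℤ.* a ℤ.+ + 2 ℤ.* T ℤ.+ (M ℤ.+ T)
  regroup = solve-∀
  collect : ∀ a T S → + 2 ℤ.* a ℤ.+ + 2 ℤ.* T ℤ.+ + 2 ℤ.* S ≡ + 2 ℤ.* (1ℤ ℤ.* a ℤ.+ (T ℤ.+ S))
  collect = solve-∀
  next : ∀ c a → a ℤ.+ c ℤ.* a ≡ (1ℤ ℤ.+ c) ℤ.* a
  next = solve-∀

pos-sum : ∀ {k} (f : Fin k → ℕ) → + ℕ∑.sum f ≡ sum (λ j → + f j)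
pos-sum {zero}  f = refl
pos-sum {suc k} f = cong (ℤ._+_ (+ f zero)) (pos-sum (f ∘ suc))

opaque
  unfolding ∑<

  sum-∑<-comm : ∀ {k} n (f : Fin k → ℕ → ℤ) → sum (λ j → ∑< n (f j)) ≡ ∑< n (λ x → sum (λ j → f j x))
  sum-∑<-comm {k} n f = ∑.∑-comm {k} {n} (λ j x → f j (toℕ x))

increasing⇒injective : ∀ {k} {a : Fin k → ℕ} → (∀ {i j} → i Fin.< j → a i < a j) → ∀ {i j} → a i ≡ a j → i ≡ j
increasing⇒injective a-mono {i} {j} ai≡aj with Finₚ.<-cmp i j
... | tri< i<j _ _ = contradiction ai≡aj (ℕₚ.<⇒≢ (a-mono i<j))
... | tri≈ _ i≡j _ = i≡j
... | tri> _ _ j<i = contradiction (sym ai≡aj) (ℕₚ.<⇒≢ (a-mono j<i))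

module Totatives {n k} (1<n : 1 < n) (a : Fin k → ℕ) (a-mono : ∀ {i j} → i Fin.< j → a i < a j)
  (a-range : ∀ x → (∃[ j ] a j ≡ x) ⇔ (0 < x × x < n × Coprime x n)) {L} (S : PrimeSupport n L) where

  private
    instance
      n≢0 : NonZero n
      n≢0 = >-nonZero (ℕₚ.<-trans (s≤s z≤n) 1<n)

    totative : ∀ j → 0 < a j × a j < n × Coprime (a j) n
    totative j = Equivalence.to (a-range (a j)) (j , refl)

    count : ∀ x → x < n → sum (λ j → ⟦ a j ℕₚ.≟ x ⟧) ≡ χ L x
    count x x<n = trans (by-cases (coprime? x n)) (coprime≡χ S x)
      where
      -- The sums `∑<` start at 0 whereas totatives are positive. The two agree since 0 is coprime
      -- only to 1.
      positive : ∀ x → Coprime x n → 0 < x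
      positive zero    coprime = contradiction (sym (Coprimality.0-coprimeTo-m⇒m≡1 coprime)) (ℕₚ.<⇒≢ 1<n)
      positive (suc x) coprime = s≤s z≤n
      by-cases : Dec (Coprime x n) → sum (λ j → ⟦ a j ℕₚ.≟ x ⟧) ≡ ⟦ coprime? x n ⟧
      by-cases (yes coprime) with j , refl ← Equivalence.from (a-range x) (positive x coprime , x<n , coprime) = begin
        sum (λ i → ⟦ a i ℕₚ.≟ a j ⟧)  ≡⟨ sum-select (λ i → ⟦ a i ℕₚ.≟ a j ⟧) j (λ i i≢j → ⟦⟧-false (a i ℕₚ.≟ a j) (i≢j ∘ increasing⇒injective a-mono)) ⟩
        ⟦ a j ℕₚ.≟ a j ⟧              ≡⟨ ⟦⟧-true (a j ℕₚ.≟ a j) refl ⟩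
        1ℤ                            ≡⟨ ⟦⟧-true (coprime? (a j) n) coprime ⟨
        ⟦ coprime? (a j) n ⟧          ∎
      by-cases (no ¬coprime) = begin
        sum (λ i → ⟦ a i ℕₚ.≟ x ⟧)    ≡⟨ ∑.sum-cong-≗ {k} (λ i → ⟦⟧-false (a i ℕₚ.≟ x) λ ai≡x → ¬coprime (subst (λ z → Coprime z n) ai≡x (proj₂ (proj₂ (totative i))))) ⟩
        sum {k} (λ _ → 0ℤ)            ≡⟨ ∑.sum-replicate-zero k ⟩
        0ℤ                            ≡⟨ ⟦⟧-false (coprime? x n) ¬coprime ⟨
        ⟦ coprime? x n ⟧              ∎

  sum-totatives : ∀ (F : ℕ → ℤ) → sum (λ j → F (a j)) ≡ ∑< n (λ x → χ L x ℤ.* F x)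
  sum-totatives F = begin
    sum (λ j → F (a j))
      ≡⟨ ∑.sum-cong-≗ {k} (λ j → sym (pick j)) ⟩
    sum (λ j → ∑< n (λ x → ⟦ a j ℕₚ.≟ x ⟧ ℤ.* F x))
      ≡⟨ sum-∑<-comm n (λ j x → ⟦ a j ℕₚ.≟ x ⟧ ℤ.* F x) ⟩
    ∑< n (λ x → sum (λ j → ⟦ a j ℕₚ.≟ x ⟧ ℤ.* F x))
      ≡⟨ ∑<-cong n (λ x x<n → trans (sym (∑.*-distribʳ-sum {k} (F x) (λ j → ⟦ a j ℕₚ.≟ x ⟧))) (cong (ℤ._* F x) (count x x<n))) ⟩
    ∑< n (λ x → χ L x ℤ.* F x) ∎
    where
    pick : ∀ j → ∑< n (λ x → ⟦ a j ℕₚ.≟ x ⟧ ℤ.* F x) ≡ F (a j)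
    pick j = begin
      ∑< n (λ x → ⟦ a j ℕₚ.≟ x ⟧ ℤ.* F x)
        ≡⟨ ∑<-select n (λ x → ⟦ a j ℕₚ.≟ x ⟧ ℤ.* F x) (a j) (proj₁ (proj₂ (totative j)))
             (λ x _ x≢aj → cong (ℤ._* F x) (⟦⟧-false (a j ℕₚ.≟ x) (x≢aj ∘ sym))) ⟩
      ⟦ a j ℕₚ.≟ a j ⟧ ℤ.* F (a j)
        ≡⟨ cong (ℤ._* F (a j)) (⟦⟧-true (a j ℕₚ.≟ a j) refl) ⟩
      1ℤ ℤ.* F (a j)
        ≡⟨ ℤₚ.*-identityˡ (F (a j)) ⟩
      F (a j) ∎

  sum-Δ-totatives : sum (λ j → sum (λ i → Δ (+ n) (a j) (a i))) ≡
    ∑< n (λ t → κ (+ n) (+ t) ℤ.* ∑< n (λ y → χ L y ℤ.* χ L (y + t)))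
  sum-Δ-totatives = begin
    sum (λ j → sum (λ i → Δ (+ n) (a j) (a i)))
      ≡⟨ ∑.sum-cong-≗ {k} (λ j → sum-totatives (Δ (+ n) (a j))) ⟩
    sum (λ j → ∑< n (λ x → χ L x ℤ.* Δ (+ n) (a j) x))
      ≡⟨ sum-totatives (λ y → ∑< n (λ x → χ L x ℤ.* Δ (+ n) y x)) ⟩
    ∑< n (λ y → χ L y ℤ.* ∑< n (λ x → χ L x ℤ.* Δ (+ n) y x))
      ≡⟨ ∑∑Δ n (χ L) (χ-periodic S) ⟩
    ∑< n (λ t → κ (+ n) (+ t) ℤ.* ∑< n (λ y → χ L y ℤ.* χ L (y + t))) ∎

-- Elimination of the sum of maxima and passage to the rationals.

-- The sum of maxima `M` occurs in `Q` with the factor 2n, so the identity is first proved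
-- multiplied by `n`. Then 12 n (M + T) equals 6 Q plus multiples of 2 T, 6 U and (2 T)², all of
-- which have known values.
combine : ∀ n f ε w M T U Q s .{{_ : ℤ.NonZero n}} →
  + 2 ℤ.* T ≡ n ℤ.* f →
  + 6 ℤ.* U ≡ n ℤ.* (+ 2 ℤ.* n ℤ.* f ℤ.+ ε) →
  + 6 ℤ.* Q ≡ n ℤ.* (n ℤ.* f ℤ.* f ℤ.- w ℤ.* f) →
  Q ≡ + 2 ℤ.* n ℤ.* M ℤ.- + 2 ℤ.* n ℤ.* f ℤ.* T ℤ.- + 2 ℤ.* f ℤ.* U ℤ.+ + 2 ℤ.* T ℤ.* T →
  M ℤ.+ T ≡ + 2 ℤ.* s →
  s ℤ.* + 24 ≡ f ℤ.* (+ 8 ℤ.* n ℤ.* f ℤ.+ + 6 ℤ.* n ℤ.+ + 2 ℤ.* ε ℤ.- w)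
combine n f ε w M T U Q s 2T≡ 6U≡ 6Q≡ Q≡ M+T≡ = ℤₚ.*-cancelˡ-≡ n _ _ (begin
  n ℤ.* (s ℤ.* + 24)
    ≡⟨ regroup₁ n s ⟩
  + 12 ℤ.* n ℤ.* (+ 2 ℤ.* s)
    ≡⟨ cong (+ 12 ℤ.* n ℤ.*_) M+T≡ ⟨
  + 12 ℤ.* n ℤ.* (M ℤ.+ T)
    ≡⟨ regroup₂ n f M T U ⟩
  + 6 ℤ.* (+ 2 ℤ.* n ℤ.* M ℤ.- + 2 ℤ.* n ℤ.* f ℤ.* T ℤ.- + 2 ℤ.* f ℤ.* U ℤ.+ + 2 ℤ.* T ℤ.* T)
    ℤ.+ + 6 ℤ.* (n ℤ.* f ℤ.+ n) ℤ.* (+ 2 ℤ.* T) ℤ.+ + 2 ℤ.* f ℤ.* (+ 6 ℤ.* U) ℤ.- + 3 ℤ.* (+ 2 ℤ.* T) ℤ.* (+ 2 ℤ.* T)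
    ≡⟨ cong (λ q → + 6 ℤ.* q ℤ.+ + 6 ℤ.* (n ℤ.* f ℤ.+ n) ℤ.* (+ 2 ℤ.* T) ℤ.+ + 2 ℤ.* f ℤ.* (+ 6 ℤ.* U) ℤ.- + 3 ℤ.* (+ 2 ℤ.* T) ℤ.* (+ 2 ℤ.* T)) (sym Q≡) ⟩
  + 6 ℤ.* Q ℤ.+ + 6 ℤ.* (n ℤ.* f ℤ.+ n) ℤ.* (+ 2 ℤ.* T) ℤ.+ + 2 ℤ.* f ℤ.* (+ 6 ℤ.* U) ℤ.- + 3 ℤ.* (+ 2 ℤ.* T) ℤ.* (+ 2 ℤ.* T)
    ≡⟨ cong₂ (λ q t → q ℤ.+ + 6 ℤ.* (n ℤ.* f ℤ.+ n) ℤ.* t ℤ.+ + 2 ℤ.* f ℤ.* (+ 6 ℤ.* U) ℤ.- + 3 ℤ.* t ℤ.* t) 6Q≡ 2T≡ ⟩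
  n ℤ.* (n ℤ.* f ℤ.* f ℤ.- w ℤ.* f) ℤ.+ + 6 ℤ.* (n ℤ.* f ℤ.+ n) ℤ.* (n ℤ.* f) ℤ.+ + 2 ℤ.* f ℤ.* (+ 6 ℤ.* U) ℤ.- + 3 ℤ.* (n ℤ.* f) ℤ.* (n ℤ.* f)
    ≡⟨ cong (λ u → n ℤ.* (n ℤ.* f ℤ.* f ℤ.- w ℤ.* f) ℤ.+ + 6 ℤ.* (n ℤ.* f ℤ.+ n) ℤ.* (n ℤ.* f) ℤ.+ + 2 ℤ.* f ℤ.* u ℤ.- + 3 ℤ.* (n ℤ.* f) ℤ.* (n ℤ.* f)) 6U≡ ⟩
  n ℤ.* (n ℤ.* f ℤ.* f ℤ.- w ℤ.* f) ℤ.+ + 6 ℤ.* (n ℤ.* f ℤ.+ n) ℤ.* (n ℤ.* f) ℤ.+ + 2 ℤ.* f ℤ.* (n ℤ.* (+ 2 ℤ.* n ℤ.* f ℤ.+ ε)) ℤ.- + 3 ℤ.* (n ℤ.* f) ℤ.* (n ℤ.* f)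
    -- The coefficient 8 of n² f² arises as 1 + 6 + 4 - 3, from `Q`, from `T`, from `U` and from the
    -- square of `T`.
    ≡⟨ regroup₃ n f ε w ⟩
  n ℤ.* (f ℤ.* (+ 8 ℤ.* n ℤ.* f ℤ.+ + 6 ℤ.* n ℤ.+ + 2 ℤ.* ε ℤ.- w)) ∎)
  where
  regroup₁ : ∀ n s → n ℤ.* (s ℤ.* + 24) ≡ + 12 ℤ.* n ℤ.* (+ 2 ℤ.* s)
  regroup₁ = solve-∀
  regroup₂ : ∀ n f M T U → + 12 ℤ.* n ℤ.* (M ℤ.+ T) ≡
    + 6 ℤ.* (+ 2 ℤ.* n ℤ.* M ℤ.- + 2 ℤ.* n ℤ.* f ℤ.* T ℤ.- + 2 ℤ.* f ℤ.* U ℤ.+ + 2 ℤ.* T ℤ.* T)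
      ℤ.+ + 6 ℤ.* (n ℤ.* f ℤ.+ n) ℤ.* (+ 2 ℤ.* T) ℤ.+ + 2 ℤ.* f ℤ.* (+ 6 ℤ.* U) ℤ.- + 3 ℤ.* (+ 2 ℤ.* T) ℤ.* (+ 2 ℤ.* T)
  regroup₂ = solve-∀
  regroup₃ : ∀ n f ε w →
    n ℤ.* (n ℤ.* f ℤ.* f ℤ.- w ℤ.* f) ℤ.+ + 6 ℤ.* (n ℤ.* f ℤ.+ n) ℤ.* (n ℤ.* f) ℤ.+ + 2 ℤ.* f ℤ.* (n ℤ.* (+ 2 ℤ.* n ℤ.* f ℤ.+ ε)) ℤ.- + 3 ℤ.* (n ℤ.* f) ℤ.* (n ℤ.* f) ≡
    n ℤ.* (f ℤ.* (+ 8 ℤ.* n ℤ.* f ℤ.+ + 6 ℤ.* n ℤ.+ + 2 ℤ.* ε ℤ.- w))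
  regroup₃ = solve-∀

pos-^ : ∀ m k → + (m ^ k) ≡ (+ m) ℤ.^ k
pos-^ m zero    = refl
pos-^ m (suc k) = trans (ℤₚ.pos-* m (m ^ k)) (cong (+ m ℤ.*_) (pos-^ m k))

-- Since `_/_` reduces to lowest terms, the comparison is made among unnormalised fractions, where
-- equality is cross-multiplication.
/-from-cross : ∀ (s f x : ℤ) (d : ℕ) .{{_ : NonZero d}} → s ℤ.* + d ≡ f ℤ.* x → s / 1 ≡ (f / d) ℚ.* (x / 1)
/-from-cross s f x d@(suc d-1) eq = ℚₚ.toℚᵘ-injective (begin-equality
  ℚ.toℚᵘ (s / 1)                              ≃⟨ ℚₚ.toℚᵘ-fromℚᵘ (ℚᵘ.mkℚᵘ s 0) ⟩
  ℚᵘ.mkℚᵘ s 0                                 ≃⟨ ℚᵘ.*≡* cross ⟩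
  ℚᵘ.mkℚᵘ f d-1 ℚᵘ.* ℚᵘ.mkℚᵘ x 0              ≃⟨ ℚᵘₚ.*-cong (ℚₚ.toℚᵘ-fromℚᵘ (ℚᵘ.mkℚᵘ f d-1)) (ℚₚ.toℚᵘ-fromℚᵘ (ℚᵘ.mkℚᵘ x 0)) ⟨
  ℚ.toℚᵘ (f / d) ℚᵘ.* ℚ.toℚᵘ (x / 1)          ≃⟨ ℚₚ.toℚᵘ-homo-* (f / d) (x / 1) ⟨
  ℚ.toℚᵘ ((f / d) ℚ.* (x / 1))                ∎′)
  where
  open ℚᵘₚ.≤-Reasoning renaming (_∎ to _∎′) hiding (begin_; step-≡-⟩; step-≡-⟨; step-≡-∣)
  cross : s ℤ.* + (d * 1) ≡ (f ℤ.* x) ℤ.* 1ℤ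
  cross = trans (cong (λ z → s ℤ.* + z) (ℕₚ.*-identityʳ d)) (trans eq (sym (ℤₚ.*-identityʳ (f ℤ.* x))))

-- A number and its radical have the same prime divisors.
product-support⁻ : ∀ {n L L′} → PrimeSupport n L → PrimeSupport (product L) L′ → PrimeSupport n L′
product-support⁻ {L = L} S S′ = record
  { primes   = primes S′
  ; unique   = unique S′
  ; divides∈ = λ p∈L′ → divides∈ S (complete (product-support S) (All.lookup (primes S′) p∈L′) (divides∈ S′ p∈L′))
  ; complete = λ p-prime p∣n → complete S′ p-prime (∈⇒∣product (complete S p-prime p∣n))
  }
  where open PrimeSupport

support⇒product∣ : ∀ {n L L′} → PrimeSupport n L → PrimeSupport n L′ → product L ∣ product L′
support⇒product∣ {L′ = L′} S S′ = distinct-primes∣⇒product∣ (product L′) (primes S) (unique S)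
  (All.tabulate λ p∈L → ∈⇒∣product (complete S′ (All.lookup (primes S) p∈L) (divides∈ S p∈L)))
  where open PrimeSupport

theorem1 : ∀ (n : ℕ) → 1 < n →
    ∀ (a : Fin (φ n) → ℕ) →
    (∀ {i j} → i Fin.< j → a i < a j) →
    (∀ k → (∃[ j ] a j ≡ k) ⇔ (0 < k × k < n × Coprime k n)) →
    let m = radical n in
    (+ (∑[ j < φ n ] (suc (toℕ j) * a j))) / 1
    ≡ ((+ φ n) / 24) ℚ.*
    ((+ (8 * n * φ n) ℤ.+ + (6 * n) ℤ.+ + (2 * φ m) ℤ.* (-1ℤ ℤ.^ ω m) ℤ.- + (2 ^ ω m)) / 1)
theorem1 n 1<n a a-mono a-range = /-from-cross (+ S) (+ φ n) _ 24 (begin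
  + S ℤ.* + 24
    ≡⟨ cong (ℤ._* + 24) (trans (pos-sum (λ j → suc (toℕ j) * a j)) (∑.sum-cong-≗ {φ n} (λ j → ℤₚ.pos-* (suc (toℕ j)) (a j)))) ⟩
  sum (λ j → + suc (toℕ j) ℤ.* + a j) ℤ.* + 24
    ≡⟨ combine (+ n) (+ φ n) ε ((+ 2) ℤ.^ length L) _ T U Q _
         (trans (cong (+ 2 ℤ.*_) (sum-totatives (λ x → + x))) ∑χ·x)
         (trans (cong (+ 6 ℤ.*_) (sum-totatives (λ x → + x ℤ.* + x))) ∑χ·x²)
         (trans (cong (+ 6 ℤ.*_) sum-Δ-totatives) ∑κ·correlation)
         (sum-Δ (+ n) a)
         (sum-max a a-mono) ⟩
  + φ n ℤ.* (+ 8 ℤ.* + n ℤ.* + φ n ℤ.+ + 6 ℤ.* + n ℤ.+ + 2 ℤ.* ε ℤ.- (+ 2) ℤ.^ length L)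
    ≡⟨ cong (+ φ n ℤ.*_) (cong₂ ℤ._-_ (cong₂ ℤ._+_ (cong₂ ℤ._+_ 8nφ (sym (ℤₚ.pos-* 6 n))) 2ε) (sym (pos-^ 2 (length L)))) ⟩
  + φ n ℤ.* (+ (8 * n * φ n) ℤ.+ + (6 * n) ℤ.+ + (2 * φ m) ℤ.* (-1ℤ ℤ.^ ω m) ℤ.- + (2 ^ ω m)) ∎)
  where
  instance
    n≢0 : NonZero n
    n≢0 = >-nonZero (ℕₚ.<-trans (s≤s z≤n) 1<n)
  m = radical n
  supp = primeDivisors-support n
  instance
    m≢0 : NonZero m
    m≢0 = productOfPrimes≢0 (PrimeSupport.primes supp)
  -- ω m is the length of primeDivisors m, so this list is used throughout rather than primeDivisors n.
  L = primeDivisors m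
  supp-m : PrimeSupport n L
  supp-m = product-support⁻ supp (primeDivisors-support m)
  -- Both lists consist of the primes dividing `n`. Mutual divisibility equates their products
  -- without any comparison of the order of the entries.
  m≡ : product L ≡ m
  m≡ = ∣-antisym (support⇒product∣ supp-m supp) (support⇒product∣ supp supp-m)
  open Moments 1<n supp-m
  open Totatives 1<n a a-mono a-range supp-m
  S = ∑[ j < φ n ] (suc (toℕ j) * a j)
  T = sum (λ i → + a i)
  U = sum (λ i → + a i ℤ.* + a i)
  Q = sum (λ j → sum (λ i → Δ (+ n) (a j) (a i)))
  8nφ : + 8 ℤ.* + n ℤ.* + φ n ≡ + (8 * n * φ n)
  8nφ = sym (trans (ℤₚ.pos-* (8 * n) (φ n)) (cong (ℤ._* + φ n) (ℤₚ.pos-* 8 n)))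
  2ε : + 2 ℤ.* ε ≡ + (2 * φ m) ℤ.* (-1ℤ ℤ.^ ω m)
  2ε = begin
    + 2 ℤ.* (+ φ (product L) ℤ.* -1ℤ ℤ.^ ω m)  ≡⟨ ℤₚ.*-assoc (+ 2) (+ φ (product L)) (-1ℤ ℤ.^ ω m) ⟨
    + 2 ℤ.* + φ (product L) ℤ.* -1ℤ ℤ.^ ω m    ≡⟨ cong (ℤ._* -1ℤ ℤ.^ ω m) (sym (ℤₚ.pos-* 2 (φ (product L)))) ⟩
    + (2 * φ (product L)) ℤ.* -1ℤ ℤ.^ ω m      ≡⟨ cong (λ k → + (2 * φ k) ℤ.* -1ℤ ℤ.^ ω m) m≡ ⟩
    + (2 * φ m) ℤ.* -1ℤ ℤ.^ ω m                ∎
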